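{- Fix an integer $d \geq 3$. Then, as $n \to \infty$, $$(1 - o_n(1))\, \frac{1}{4ed^4} \;\leq\; \frac{H_{pm}(n, d)\, d!}{n^{d-1}} \;\leq\; \frac{6}{d+1}.$$
   Context: For a pure simplicial complex $C$, its facets are its top-dimensional faces and its ridges are its faces of codimension one. The dual graph $G(C)$ has the facets of $C$ as vertices, two facets being adjacent if they intersect in a ridge. $C$ is strongly connected if $G(C)$ is connected, and the combinatorial diameter of $C$ is the graph diameter of $G(C)$. A (d-1)-dimensional pseudomanifold (without boundary) is a pure $(d-1)$-dimensional simplicial complex in which every ridge is contained in exactly two facets. $H_{pm}(n,d)$ denotes the largest combinatorial diameter of a strongly connected $(d-1)$-dimensional pseudomanifold on $n$ vertices. Here $e$ is Euler's number and $o_n(1)$ denotes a quantity tending to $0$ as $n\to\infty$ (with $d$ fixed). -}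

module Defs where

open import Data.Nat using (ℕ; zero; suc; _∸_)
open import Data.Nat.Base using (_!)
open import Data.Nat.Properties using (_!≢0)
open import Data.Fin using (Fin)
open import Data.Fin.Subset using (Subset; _∈_; _⊆_; _∩_; ∣_∣)
open import Data.Integer using (+_)
open import Data.Rational as ℚ using (ℚ; _/_; 0ℚ; _+_; _≤_; _<_)
open import Data.Product using (Σ; ∃; _×_; ∃-syntax)
open import Relation.Binary.PropositionalEquality using (_≡_; _≢_)

-- A pure (d-1)-dimensional simplicial complex on vertex set Fin n is given by
-- its set of facets, a predicate on subsets of Fin n.
Complex : ℕ → Set₁
Complex n = Subset n → Set

module _ {n : ℕ} (C : Complex n) where

  Pure : ℕ → Set
  Pure d = ∀ F → C F → ∣ F ∣ ≡ d

  UsesAllVertices : Set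
  UsesAllVertices = ∀ (i : Fin n) → ∃[ F ] (C F × i ∈ F)

  Ridge : ℕ → Subset n → Set
  Ridge d R = ∣ R ∣ ≡ d ∸ 1 × ∃[ F ] (C F × R ⊆ F)

  PseudomanifoldCond : ℕ → Set
  PseudomanifoldCond d = ∀ R → Ridge d R →
    ∃[ F₁ ] ∃[ F₂ ] (C F₁ × C F₂ × F₁ ≢ F₂ × R ⊆ F₁ × R ⊆ F₂ ×
      (∀ G → C G → R ⊆ G → G ≡ F₁ ⊎' G ≡ F₂))
    where
      open import Data.Sum using () renaming (_⊎_ to _⊎'_)

  Adj : ℕ → Subset n → Subset n → Set
  Adj d F G = C F × C G × F ≢ G × ∣ F ∩ G ∣ ≡ d ∸ 1

  data Walk (d : ℕ) : Subset n → Subset n → ℕ → Set where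
    here : ∀ {F} → C F → Walk d F F 0
    step : ∀ {F H G k} → Adj d F H → Walk d H G k → Walk d F G (suc k)

  StronglyConnected : ℕ → Set
  StronglyConnected d = ∀ F G → C F → C G → ∃[ k ] Walk d F G k

IsSCPM : (n d : ℕ) → Complex n → Set
IsSCPM n d C = Pure C d × UsesAllVertices C × PseudomanifoldCond C d
             × StronglyConnected C d

-- Euler's number e = sup_k s_k with s_k = Σ_{j ≤ k} 1/j!
ℕtoℚ : ℕ → ℚ
ℕtoℚ m = (+ m) / 1

invFact : ℕ → ℚ
invFact j = ((+ 1) / (j !)) {{j !≢0}}

eSum : ℕ → ℚ
eSum zero    = invFact 0
eSum (suc k) = eSum k + invFact (suc k)

-- "e < r": r exceeds the supremum e of the partial sums strictly
EulerLt : ℚ → Set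
EulerLt r = ∃[ δ ] (0ℚ < δ × (∀ k → eSum k + δ ≤ r))

{-# OPTIONS --safe #-}
-- Upper bound: the closed neighbourhoods of every third facet of a geodesic are disjoint and each
-- has d + 1 facets, while a pseudomanifold has at most 2 n^(d-1) / d! facets.  A walk violating
-- this disjointness can be shortened, so no search for a geodesic is needed.
--
-- Lower bound: a word x₁ x₂ ... over the vertices describes a stacked tube: start from the boundary
-- of a d-simplex on the first d + 1 letters and let each further letter subdivide the facet spanned
-- by the last d letters.  The result is a pseudomanifold as long as no new ridge already
-- exists, and since adjacent facets have creation times differing by at most 2, its diameter is at
-- least half the number of subdivisions.  Long words are found by counting (in the style of
-- Rosenfeld): the number V(t) of good words of length t satisfies V(t+1) ≥ β V(t), because a bad
-- extension of a word of length t either repeats one of the last 2d letters or is determined by a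
-- good word of length t - d, an earlier window, and a placement of d - 1 of its letters in the last
-- d + 1 positions.  Letters not yet used can be appended freely, so every vertex occurs.
module Submission where

open import Defs
open import Data.Nat using (ℕ; zero; suc; _∸_; _^_; _≤_; _!; _*_; _+_; z≤n; s≤s; _≤?_; >-nonZero) renaming (_<_ to _<ⁿ_)
open import Data.Nat.Properties
open import Data.Nat.DivMod using (_/_; _%_; m≡m%n+[m/n]*n; m%n<n; m≥n⇒m/n>0)
open import Data.Nat.ListAction using (sum)
open import Data.Nat.Induction using (<-wellFounded)
open import Data.Nat.Tactic.RingSolver using (solve-∀)
open import Induction.WellFounded using (Acc; acc)
import Data.Bool.Properties as Bool
open import Data.Fin using (Fin; zero; suc)
import Data.Fin.Properties as Fin
open import Data.Fin.Subset using (Subset; inside; outside; _∈_; _∉_; _⊆_; _∩_; _∪_; _─_; ⊥; ⁅_⁆; ∣_∣) renaming (_-_ to _∖_)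
open import Data.Fin.Subset.Properties
open import Data.Vec using ([]; _∷_; here; there)
import Data.Vec.Properties as Vec
open import Data.List using (List; []; _∷_; _++_; length; map; filter; allFin; take; drop; concatMap; cartesianProductWith)
import Data.List.Properties as List
open import Data.List.Membership.Propositional using (find; lose) renaming (_∈_ to _∈ˡ_; _∉_ to _∉ˡ_)
import Data.List.Membership.Propositional.Properties as Mem
import Data.List.Membership.DecPropositional as DecMem
open import Data.List.Relation.Unary.Any using (Any; here; there)
import Data.List.Relation.Unary.Any as Any
open import Data.List.Relation.Unary.All using (All; []; _∷_)
import Data.List.Relation.Unary.All as All
open import Data.List.Relation.Unary.AllPairs using ([]; _∷_)
open import Data.List.Relation.Unary.Unique.Propositional using (Unique)
import Data.List.Relation.Unary.Unique.Propositional.Properties as Unique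
import Data.Integer as Int
import Data.Integer.Properties as ℤ
open import Data.Rational using (ℚ; 0ℚ; 1ℚ; _<_; _-_)
import Data.Rational as Q
import Data.Rational.Properties as Q
import Data.Rational.Unnormalised as Qᵘ
import Data.Rational.Unnormalised.Properties as Qᵘ
open import Data.Product using (_×_; _,_; ∃-syntax; proj₁; proj₂)
open import Data.Sum using (_⊎_; inj₁; inj₂; [_,_]′; swap)
open import Function using (_∘_; id)
open import Relation.Nullary using (¬_; Dec; yes; no; contradiction; ¬?)
open import Relation.Nullary.Decidable using (_×-dec_; toSum)
open import Relation.Unary using () renaming (Decidable to Decidable₁)
open import Relation.Binary.PropositionalEquality using (_≡_; _≢_; refl; sym; trans; cong; cong₂; subst; subst₂; ≢-sym; module ≡-Reasoning)

private variable
  n : ℕ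
  A B : Set

-- Finite subsets and their cardinalities

x∈p─q⇒x∉q : ∀ {x} (p q : Subset n) → x ∈ p ─ q → x ∉ q
x∈p─q⇒x∉q {x = zero}  (_ ∷ _) (inside ∷ _)  () 
x∈p─q⇒x∉q {x = zero}  (_ ∷ _) (outside ∷ _) _ ()
x∈p─q⇒x∉q {x = suc _} (_ ∷ p) (_ ∷ q) (there x∈) (there x∈q) = x∈p─q⇒x∉q p q x∈ x∈q

x∉p-x : ∀ (p : Subset n) x → x ∉ p ∖ x
x∉p-x p x x∈ = x∈p─q⇒x∉q p ⁅ x ⁆ x∈ (x∈⁅x⁆ x)

x∈p-y⇒x≢y : ∀ {x y} (p : Subset n) → x ∈ p ∖ y → x ≢ y
x∈p-y⇒x≢y p x∈ refl = x∉p-x p _ x∈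

p-x⊆p : ∀ (p : Subset n) x → p ∖ x ⊆ p
p-x⊆p p x = p─q⊆p p ⁅ x ⁆

⊆-remove : ∀ {p q : Subset n} {x} → p ⊆ q → x ∉ p → p ⊆ q ∖ x
⊆-remove p⊆q x∉p y∈p = x∈p∧x≢y⇒x∈p-y (p⊆q y∈p) λ { refl → x∉p y∈p }

∣p-x∣ : ∀ {p : Subset n} {x} → x ∈ p → suc ∣ p ∖ x ∣ ≡ ∣ p ∣
∣p-x∣ {p = inside ∷ p} here = cong (suc ∘ ∣_∣) (p─⊥≡p p)
∣p-x∣ {p = inside ∷ p} (there x∈p) = cong suc (∣p-x∣ x∈p)
∣p-x∣ {p = outside ∷ p} (there x∈p) = ∣p-x∣ x∈p

∣p∪x∣ : ∀ {p : Subset n} {x} → x ∉ p → ∣ p ∪ ⁅ x ⁆ ∣ ≡ suc ∣ p ∣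
∣p∪x∣ {p = inside ∷ p} {zero} x∉p = contradiction here x∉p
∣p∪x∣ {p = outside ∷ p} {zero} x∉p = cong (suc ∘ ∣_∣) (∪-identityʳ p)
∣p∪x∣ {p = inside ∷ p} {suc x} x∉p = cong suc (∣p∪x∣ (x∉p ∘ there))
∣p∪x∣ {p = outside ∷ p} {suc x} x∉p = ∣p∪x∣ (x∉p ∘ there)

∣p∣≤∣p─q∣+∣q∣ : ∀ (p q : Subset n) → ∣ p ∣ ≤ ∣ p ─ q ∣ + ∣ q ∣
∣p∣≤∣p─q∣+∣q∣ [] [] = z≤n
∣p∣≤∣p─q∣+∣q∣ (inside ∷ p) (inside ∷ q) =
  ≤-trans (s≤s (∣p∣≤∣p─q∣+∣q∣ p q)) (≤-reflexive (sym (+-suc ∣ p ─ q ∣ ∣ q ∣)))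
∣p∣≤∣p─q∣+∣q∣ (inside ∷ p) (outside ∷ q) = s≤s (∣p∣≤∣p─q∣+∣q∣ p q)
∣p∣≤∣p─q∣+∣q∣ (outside ∷ p) (inside ∷ q) =
  ≤-trans (∣p∣≤∣p─q∣+∣q∣ p q) (+-monoʳ-≤ ∣ p ─ q ∣ (n≤1+n _))
∣p∣≤∣p─q∣+∣q∣ (outside ∷ p) (outside ∷ q) = ∣p∣≤∣p─q∣+∣q∣ p q

∣p∣≤1+∣p-x∣ : ∀ (p : Subset n) x → ∣ p ∣ ≤ suc ∣ p ∖ x ∣
∣p∣≤1+∣p-x∣ p x = ≤-trans (∣p∣≤∣p─q∣+∣q∣ p ⁅ x ⁆)
  (≤-reflexive (trans (cong (∣ p ∖ x ∣ +_) (∣⁅x⁆∣≡1 x)) (+-comm _ 1)))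

⊆∧∣∣≥⇒≡ : ∀ {p q : Subset n} → p ⊆ q → ∣ q ∣ ≤ ∣ p ∣ → p ≡ q
⊆∧∣∣≥⇒≡ {p = p} {q} p⊆q ∣q∣≤∣p∣ = ⊆-antisym p⊆q q⊆p
  where
  q⊆p : q ⊆ p
  q⊆p {x} x∈q with x ∈? p
  ... | yes x∈p = x∈p
  ... | no  x∉p = contradiction (p⊂q⇒∣p∣<∣q∣ (p⊆q , x , x∈q , x∉p)) (≤⇒≯ ∣q∣≤∣p∣)

∣∣<⇒∃∈∉ : ∀ (p q : Subset n) → ∣ p ∣ <ⁿ ∣ q ∣ → ∃[ x ] (x ∈ q × x ∉ p)
∣∣<⇒∃∈∉ p q ∣p∣<∣q∣ with Fin.any? (λ x → (x ∈? q) ×-dec ¬? (x ∈? p))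
... | yes found = found
... | no  none  = contradiction (p⊆q⇒∣p∣≤∣q∣ q⊆p) (<⇒≱ ∣p∣<∣q∣)
  where
  q⊆p : q ⊆ p
  q⊆p {x} x∈q with x ∈? p
  ... | yes x∈p = x∈p
  ... | no  x∉p = contradiction (x , x∈q , x∉p) none

-- For a simplex `q` this presents a ridge of its boundary through the two facets `q ∖ a` and
-- `q ∖ b` containing it.
codim2 : ∀ (p q : Subset n) → p ⊆ q → 2 + ∣ p ∣ ≡ ∣ q ∣ →
  ∃[ a ] ∃[ b ] (a ∈ q × b ∈ q × a ≢ b × a ∉ p × b ∉ p × p ≡ q ∖ a ∖ b)
codim2 p q p⊆q eq with ∣∣<⇒∃∈∉ p q (≤-trans (n≤1+n _) (≤-reflexive eq))
... | a , a∈q , a∉p with ∣∣<⇒∃∈∉ p (q ∖ a) (≤-reflexive (suc-injective (trans eq (sym (∣p-x∣ a∈q)))))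
... | b , b∈q-a , b∉p =
  a , b , a∈q , p-x⊆p q a b∈q-a , ≢-sym (x∈p-y⇒x≢y q b∈q-a) , a∉p , b∉p ,
  ⊆∧∣∣≥⇒≡ (⊆-remove (⊆-remove p⊆q a∉p) b∉p)
    (≤-reflexive (suc-injective (suc-injective (trans (trans (cong suc (∣p-x∣ b∈q-a)) (∣p-x∣ a∈q)) (sym eq)))))

covered⇒∣∣≤length : ∀ (p : Subset n) xs → (∀ {x} → x ∈ p → x ∈ˡ xs) → ∣ p ∣ ≤ length xs
covered⇒∣∣≤length {n} p [] cov = ≤-reflexive (trans (cong ∣_∣ (Empty-unique p-empty)) (∣⊥∣≡0 n))
  where
  p-empty : ¬ (∃[ x ] x ∈ p)
  p-empty (x , x∈p) with cov x∈p
  ... | ()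
covered⇒∣∣≤length p (x ∷ xs) cov =
  ≤-trans (∣p∣≤1+∣p-x∣ p x) (s≤s (covered⇒∣∣≤length (p ∖ x) xs cov-x))
  where
  cov-x : ∀ {y} → y ∈ p ∖ x → y ∈ˡ xs
  cov-x y∈ with cov (p-x⊆p p x y∈)
  ... | here refl = contradiction y∈ (x∉p-x p x)
  ... | there y∈xs = y∈xs

unique⇒length≤ : ∀ {xs ys : List A} → Unique xs → (∀ {x} → x ∈ˡ xs → x ∈ˡ ys) → length xs ≤ length ys
unique⇒length≤ {xs = []} _ _ = z≤n
unique⇒length≤ {xs = x ∷ xs} (x∉xs ∷ u) xs⊆ys with Mem.∈-∃++ (xs⊆ys (here refl))
... | as , bs , refl = ≤-trans (s≤s (unique⇒length≤ u xs⊆as++bs)) (≤-reflexive eq)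
  where
  eq : suc (length (as ++ bs)) ≡ length (as ++ x ∷ bs)
  eq = trans (cong suc (List.length-++ as)) (trans (sym (+-suc (length as) _)) (sym (List.length-++ as)))
  xs⊆as++bs : ∀ {y} → y ∈ˡ xs → y ∈ˡ as ++ bs
  xs⊆as++bs y∈xs with Mem.∈-++⁻ as (xs⊆ys (there y∈xs))
  ... | inj₁ y∈as = Mem.∈-++⁺ˡ y∈as
  ... | inj₂ (here refl) = contradiction refl (All.lookup x∉xs y∈xs)
  ... | inj₂ (there y∈bs) = Mem.∈-++⁺ʳ as y∈bs

elements : Subset n → List (Fin n)
elements p = filter (_∈? p) (allFin _)

elements-unique : ∀ (p : Subset n) → Unique (elements p)
elements-unique p = Unique.filter⁺ (_∈? p) (Unique.allFin⁺ _)

∈-elements⁺ : ∀ (p : Subset n) {x} → x ∈ p → x ∈ˡ elements p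
∈-elements⁺ p x∈p = Mem.∈-filter⁺ (_∈? p) (Mem.∈-allFin _) x∈p

∈-elements⁻ : ∀ (p : Subset n) {x} → x ∈ˡ elements p → x ∈ p
∈-elements⁻ p x∈ = proj₂ (Mem.∈-filter⁻ (_∈? p) {xs = allFin _} x∈)

_≟ˢ_ : (p q : Subset n) → Dec (p ≡ q)
_≟ˢ_ = Vec.≡-dec Bool._≟_

-- Sums over lists and double counting

length-filter-∷ : ∀ {P : A → Set} (P? : Decidable₁ P) x xs →
  length (filter P? (x ∷ xs)) ≡ length (filter P? (x ∷ [])) + length (filter P? xs)
length-filter-∷ P? x xs with P? x
... | yes _ = refl
... | no  _ = refl

sum-map-0 : ∀ (xs : List A) → sum (map (λ _ → 0) xs) ≡ 0
sum-map-0 [] = refl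
sum-map-0 (_ ∷ xs) = sum-map-0 xs

sum-map-+ : ∀ (f g : A → ℕ) xs → sum (map (λ x → f x + g x) xs) ≡ sum (map f xs) + sum (map g xs)
sum-map-+ f g [] = refl
sum-map-+ f g (x ∷ xs) rewrite sum-map-+ f g xs = interchange (f x) (g x) _ _
  where
  interchange : ∀ a b c d → a + b + (c + d) ≡ a + c + (b + d)
  interchange = solve-∀

sum-map-mono : ∀ {f g : A → ℕ} (xs : List A) → (∀ {x} → x ∈ˡ xs → f x ≤ g x) → sum (map f xs) ≤ sum (map g xs)
sum-map-mono [] _ = z≤n
sum-map-mono (x ∷ xs) f≤g = +-mono-≤ (f≤g (here refl)) (sum-map-mono xs (f≤g ∘ there))

sum-map-const : ∀ c (xs : List A) → sum (map (λ _ → c) xs) ≡ length xs * c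
sum-map-const c [] = refl
sum-map-const c (_ ∷ xs) = cong (c +_) (sum-map-const c xs)

sum-map-*ʳ : ∀ (f : A → ℕ) c xs → sum (map f xs) * c ≡ sum (map (λ x → f x * c) xs)
sum-map-*ʳ f c [] = refl
sum-map-*ʳ f c (x ∷ xs) = trans (*-distribʳ-+ c (f x) _) (cong (f x * c +_) (sum-map-*ʳ f c xs))

double-counting : ∀ {Q : A → B → Set} (Q? : ∀ x y → Dec (Q x y)) xs ys →
  sum (map (λ x → length (filter (Q? x) ys)) xs) ≡ sum (map (λ y → length (filter (λ x → Q? x y) xs)) ys)
double-counting Q? [] ys = sym (sum-map-0 ys)
double-counting Q? (x ∷ xs) ys = trans
  (cong₂ _+_ (row ys) (double-counting Q? xs ys))
  (trans (sym (sum-map-+ (λ y → length (filter (λ x′ → Q? x′ y) (x ∷ []))) (λ y → length (filter (λ x′ → Q? x′ y) xs)) ys))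
         (cong sum (List.map-cong (λ y → sym (length-filter-∷ (λ x′ → Q? x′ y) x xs)) ys)))
  where
  row : ∀ ys → length (filter (Q? x) ys) ≡ sum (map (λ y → length (filter (λ x′ → Q? x′ y) (x ∷ []))) ys)
  row [] = refl
  row (y ∷ ys) with Q? x y
  ... | yes _ = cong suc (row ys)
  ... | no  _ = row ys

-- Counting the facets of a pseudomanifold

-- Weaker than the pseudomanifold condition: `F₁` and `F₂` may coincide or lie outside `L`, so the
-- property passes to sublists such as links.
AtMostTwo : List (Subset n) → ℕ → Set
AtMostTwo L r = ∀ R → ∣ R ∣ ≡ r → ∀ F → F ∈ˡ L → R ⊆ F →
  ∃[ F₁ ] ∃[ F₂ ] (∀ G → G ∈ˡ L → R ⊆ G → G ≡ F₁ ⊎ G ≡ F₂)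

-- By induction on j: each L-facet has j + 2 vertices outside S, and the facets through a
-- vertex v ∉ S satisfy the hypotheses for S ∪ ⁅ v ⁆ and j.
facet-count : ∀ j (S : Subset n) (L : List (Subset n)) → Unique L →
  (∀ F → F ∈ˡ L → S ⊆ F × ∣ F ∣ ≡ ∣ S ∣ + suc j) → AtMostTwo L (∣ S ∣ + j) →
  length L * suc j ! ≤ 2 * n ^ j
facet-count zero S [] u sup two = z≤n
-- Here `S` itself has the size of a ridge and lies in every facet of `L`, so `L` has at most two
-- entries.
facet-count zero S L@(F ∷ _) u sup two with two S (sym (+-identityʳ _)) F (here refl) (proj₁ (sup F (here refl)))
... | F₁ , F₂ , only = ≤-trans (≤-reflexive (*-identityʳ (length L))) (unique⇒length≤ {ys = F₁ ∷ F₂ ∷ []} u L⊆)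
  where
  L⊆ : ∀ {G} → G ∈ˡ L → G ∈ˡ F₁ ∷ F₂ ∷ []
  L⊆ {G} G∈L with only G G∈L (proj₁ (sup G G∈L))
  ... | inj₁ refl = here refl
  ... | inj₂ refl = there (here refl)
facet-count {n} (suc j) S L u sup two = begin
  length L * suc (suc j) !                            ≡⟨ sym (*-assoc (length L) (2 + j) (suc j !)) ⟩
  length L * (2 + j) * suc j !                        ≡⟨ cong (_* suc j !) (sym (sum-map-const (2 + j) L)) ⟩
  sum (map (λ _ → 2 + j) L) * suc j !                 ≤⟨ *-monoˡ-≤ (suc j !) (sum-map-mono L degree) ⟩
  sum (map (λ F → length (filter (λ v → Q? v F) (allFin n))) L) * suc j !
                                                      ≡⟨ cong (_* suc j !) (sym (double-counting Q? (allFin n) L)) ⟩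
  sum (map (λ v → length (link v)) (allFin n)) * suc j ! ≡⟨ sum-map-*ʳ (λ v → length (link v)) (suc j !) (allFin n) ⟩
  sum (map (λ v → length (link v) * suc j !) (allFin n)) ≤⟨ sum-map-mono (allFin n) (λ {v} _ → link-bound v) ⟩
  sum (map (λ _ → 2 * n ^ j) (allFin n))              ≡⟨ sum-map-const (2 * n ^ j) (allFin n) ⟩
  length (allFin n) * (2 * n ^ j)                     ≡⟨ cong (_* (2 * n ^ j)) (List.length-tabulate {n = n} id) ⟩
  n * (2 * n ^ j)                                     ≡⟨ commute n (n ^ j) ⟩
  2 * n ^ suc j                                       ∎
  where
  open ≤-Reasoning
  commute : ∀ a b → a * (2 * b) ≡ 2 * (a * b)
  commute = solve-∀
  Q? : ∀ v F → Dec (v ∈ F × v ∉ S)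
  Q? v F = (v ∈? F) ×-dec ¬? (v ∈? S)
  link : Fin n → List (Subset n)
  link v = filter (Q? v) L
  degree : ∀ {F} → F ∈ˡ L → 2 + j ≤ length (filter (λ v → Q? v F) (allFin n))
  degree {F} F∈L = ≤-trans
    (+-cancelʳ-≤ (∣ S ∣) (2 + j) (∣ F ─ S ∣)
      (≤-trans (≤-reflexive (trans (+-comm (2 + j) ∣ S ∣) (sym (proj₂ (sup F F∈L))))) (∣p∣≤∣p─q∣+∣q∣ F S)))
    (covered⇒∣∣≤length (F ─ S) _ λ {x} x∈ →
      Mem.∈-filter⁺ (λ v → Q? v F) (Mem.∈-allFin x) (p─q⊆p F S x∈ , x∈p─q⇒x∉q F S x∈))
  link-bound : ∀ v → length (link v) * suc j ! ≤ 2 * n ^ j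
  link-bound v = [ inside-S , outside-S ]′ (toSum (v ∈? S))
    where
    inside-S : v ∈ S → length (link v) * suc j ! ≤ 2 * n ^ j
    inside-S v∈S = ≤-trans (≤-reflexive (cong (λ l → length l * suc j !) none)) z≤n
     where
     none : filter (Q? v) L ≡ []
     none = List.filter-none (Q? v) (All.universal (λ _ Q → proj₂ Q v∈S) L)
    outside-S : v ∉ S → length (link v) * suc j ! ≤ 2 * n ^ j
    outside-S v∉S = facet-count j (S ∪ ⁅ v ⁆) (link v) (Unique.filter⁺ (Q? v) u) sup′ two′
     where
     size : ∀ k → ∣ S ∪ ⁅ v ⁆ ∣ + k ≡ ∣ S ∣ + suc k
     size k = trans (cong (_+ k) (∣p∪x∣ v∉S)) (sym (+-suc ∣ S ∣ k))
     sup′ : ∀ F → F ∈ˡ link v → (S ∪ ⁅ v ⁆) ⊆ F × ∣ F ∣ ≡ ∣ S ∪ ⁅ v ⁆ ∣ + suc j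
     sup′ F F∈ with Mem.∈-filter⁻ (Q? v) {xs = L} F∈
     ... | F∈L , v∈F , _ = S∪v⊆F , trans (proj₂ (sup F F∈L)) (sym (size (suc j)))
       where
       S∪v⊆F : (S ∪ ⁅ v ⁆) ⊆ F
       S∪v⊆F x∈ with x∈p∪q⁻ S ⁅ v ⁆ x∈
       ... | inj₁ x∈S = proj₁ (sup F F∈L) x∈S
       ... | inj₂ x∈v rewrite x∈⁅y⁆⇒x≡y v x∈v = v∈F
     two′ : AtMostTwo (link v) (∣ S ∪ ⁅ v ⁆ ∣ + j)
     two′ R ∣R∣ F F∈ R⊆F with two R (trans ∣R∣ (size j)) F (proj₁ (Mem.∈-filter⁻ (Q? v) {xs = L} F∈)) R⊆F
     ... | F₁ , F₂ , only = F₁ , F₂ , λ G G∈ → only G (proj₁ (Mem.∈-filter⁻ (Q? v) {xs = L} G∈))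

-- The upper bound on the diameter

module Diameter {n} (C : Complex n) (j : ℕ) (scpm : IsSCPM n (suc j) C) where

  private
    d = suc j
    pure = proj₁ scpm
    pm = proj₁ (proj₂ (proj₂ scpm))

  ∣∩∣≡j : ∀ {F G y} → C F → C G → F ≢ G → y ∈ F → F ∖ y ⊆ G → ∣ F ∩ G ∣ ≡ j
  ∣∩∣≡j {F} {G} {y} cF cG F≢G y∈F F-y⊆G with ∣ F ∩ G ∣ ≤? j
  ... | yes ≤j = ≤-antisym ≤j (≤-trans
          (≤-reflexive (suc-injective (trans (sym (pure F cF)) (sym (∣p-x∣ y∈F)))))
          (p⊆q⇒∣p∣≤∣q∣ {p = F ∖ y} λ x∈ → x∈p∩q⁺ (p-x⊆p F y x∈ , F-y⊆G x∈)))
  ... | no ≰j = contradiction F≡G F≢G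
    where
    d≤ : d ≤ ∣ F ∩ G ∣
    d≤ = ≰⇒> ≰j
    F≡G : F ≡ G
    F≡G = trans (sym (⊆∧∣∣≥⇒≡ (p∩q⊆p F G) (subst (_≤ ∣ F ∩ G ∣) (sym (pure F cF)) d≤)))
                (⊆∧∣∣≥⇒≡ (p∩q⊆q F G) (subst (_≤ ∣ F ∩ G ∣) (sym (pure G cG)) d≤))

  Neighbour : Subset n → Fin n → Subset n → Set
  Neighbour F y H = C H × F ≢ H × F ∖ y ⊆ H

  -- The ridge `F ∖ y` lies in exactly two facets and `F` is one of them; the other is returned.
  neighbour : ∀ {F y} → C F → y ∈ F → ∃[ H ] Neighbour F y H
  neighbour {F} {y} cF y∈F
    with pm (F ∖ y) (suc-injective (trans (∣p-x∣ y∈F) (pure F cF)) , F , cF , p-x⊆p F y)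
  ... | F₁ , F₂ , c₁ , c₂ , F₁≢F₂ , R⊆F₁ , R⊆F₂ , only with only F cF (p-x⊆p F y)
  ... | inj₁ refl = F₂ , c₂ , F₁≢F₂ , R⊆F₂
  ... | inj₂ refl = F₁ , c₁ , ≢-sym F₁≢F₂ , R⊆F₁

  Adj-sym : ∀ {F G} → Adj C d F G → Adj C d G F
  Adj-sym {F} {G} (cF , cG , F≢G , eq) = cG , cF , ≢-sym F≢G , trans (cong ∣_∣ (∩-comm G F)) eq

  neighbours : ∀ {F} → C F → ∀ ys → Unique ys → All (_∈ F) ys →
    ∃[ Hs ] (length Hs ≡ length ys × Unique Hs × (∀ H → H ∈ˡ Hs → ∃[ y ] (y ∈ˡ ys × Neighbour F y H)))
  neighbours cF [] _ _ = [] , refl , [] , λ _ ()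
  neighbours {F} cF (y ∷ ys) (y∉ys ∷ u) (y∈F ∷ ys⊆F) with neighbour cF y∈F | neighbours cF ys u ys⊆F
  ... | H , cH , F≢H , F-y⊆H | Hs , len , uHs , each =
    H ∷ Hs , cong suc len , All.tabulate H≢ ∷ uHs , λ where
      _ (here refl) → y , here refl , cH , F≢H , F-y⊆H
      K (there K∈) → let y′ , y′∈ , nb = each K K∈ in y′ , there y′∈ , nb
    where
    H≢ : ∀ {K} → K ∈ˡ Hs → H ≢ K
    -- A facet containing both `F ∖ y` and `F ∖ y′` with `y ≢ y′` contains `F` and hence equals it,
    -- so different ridges of `F` lead to different neighbours.
    H≢ K∈ refl with each H K∈
    ... | y′ , y′∈ , _ , _ , F-y′⊆H = F≢H (⊆∧∣∣≥⇒≡ F⊆H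
            (≤-reflexive (trans (pure H cH) (sym (pure F cF)))))
      where
      F⊆H : F ⊆ H
      F⊆H {x} x∈F with x Fin.≟ y
      ... | no x≢y = F-y⊆H (x∈p∧x≢y⇒x∈p-y x∈F x≢y)
      ... | yes refl = F-y′⊆H (x∈p∧x≢y⇒x∈p-y x∈F (All.lookup y∉ys y′∈))

  Near : Subset n → Subset n → Set
  Near F H = F ≡ H ⊎ Adj C d F H

  -- One neighbour across each of the `d` ridges of `F`, together with `F` itself.
  closedNeighbourhood : ∀ {F} → C F →
    ∃[ N ] (suc d ≤ length N × Unique N × (∀ H → H ∈ˡ N → C H × Near F H))
  closedNeighbourhood {F} cF
    with neighbours cF (elements F) (elements-unique F) (All.tabulate (∈-elements⁻ F))
  ... | Hs , len , u , each = F ∷ Hs ,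
        s≤s (≤-trans (≤-reflexive (sym (pure F cF))) (≤-trans (covered⇒∣∣≤length F _ (∈-elements⁺ F)) (≤-reflexive (sym len)))) ,
        All.tabulate (λ H∈ → proj₁ (proj₂ (proj₂ (proj₂ (each _ H∈))))) ∷ u , λ where
          _ (here refl) → cF , inj₁ refl
          H (there H∈) → let y , y∈ , cH , F≢H , F-y⊆H = each H H∈ in
            cH , inj₂ (cF , cH , F≢H , ∣∩∣≡j cF cH F≢H (∈-elements⁻ F y∈) F-y⊆H)

  Walk≤ : Subset n → Subset n → ℕ → Set
  Walk≤ F G m = ∃[ k ] (k ≤ m × Walk C d F G k)

  towards : ∀ {F H G m} → Near F H → Walk≤ H G m → Walk≤ F G (suc m)
  towards (inj₁ refl) (k , k≤m , w) = k , m≤n⇒m≤1+n k≤m , w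
  towards (inj₂ adj) (k , k≤m , w) = suc k , s≤s k≤m , step adj w

  Near-sym : ∀ {F H} → Near F H → Near H F
  Near-sym (inj₁ eq) = inj₁ (sym eq)
  Near-sym (inj₂ adj) = inj₂ (Adj-sym adj)

  source : ∀ {F G k} → Walk C d F G k → C F
  source (here cF) = cF
  source (step adj _) = proj₁ adj

  -- `L` collects disjoint closed neighbourhoods around every third facet of a walk of length `k`,
  -- whence the factor 3. The distance bound `suc k` is what turns a collision into a shortcut.
  Packing : Subset n → Subset n → ℕ → Set
  Packing F G k = ∃[ L ] (Unique L × (∀ H → H ∈ˡ L → C H × Walk≤ H G (suc k)) × suc k * suc d ≤ 3 * length L)

  -- A walk with at most three facets needs only one closed neighbourhood, as `suc k ≤ 3`.
  ball : ∀ {F G k} → k ≤ 2 → Walk C d F G k → Packing F G k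
  ball {k = k} k≤2 w with closedNeighbourhood (source w)
  ... | N , size , u , each = N , u ,
        (λ H H∈ → proj₁ (each H H∈) , towards (Near-sym (proj₂ (each H H∈))) (k , ≤-refl , w)) ,
        *-mono-≤ (s≤s k≤2) size

  -- Three steps are stripped at a time. If the closed neighbourhood of `F` meets the packing of the
  -- remaining walk of length `k` in `H`, then one step at most leads to `H` and `suc k` at most
  -- from there to `G`: fewer than `3 + k` in all.
  shorten-or-pack : ∀ {F G k} → Walk C d F G k → (∃[ k′ ] (k′ <ⁿ k × Walk C d F G k′)) ⊎ Packing F G k
  shorten-or-pack w@(here _) = inj₂ (ball z≤n w)
  shorten-or-pack w@(step _ (here _)) = inj₂ (ball (s≤s z≤n) w)
  shorten-or-pack w@(step _ (step _ (here _))) = inj₂ (ball (s≤s (s≤s z≤n)) w)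
  shorten-or-pack {F} {G} {suc (suc (suc k))} w@(step a (step b (step c w′))) with shorten-or-pack w′
  ... | inj₁ (k′ , k′<k , v) = inj₁ (3 + k′ , s≤s (s≤s (s≤s k′<k)) , step a (step b (step c v)))
  ... | inj₂ (L , uL , eachL , sizeL) with closedNeighbourhood (source w)
  ... | N , sizeN , uN , eachN with Any.any? (λ H → DecMem._∈?_ _≟ˢ_ H L) N
  ... | yes meets = inj₁ shorter
    where
    shorter : ∃[ k′ ] (k′ <ⁿ 3 + k × Walk C d F G k′)
    shorter with find meets
    ... | H , H∈N , H∈L with towards (proj₂ (eachN H H∈N)) (proj₂ (eachL H H∈L))
    ... | k′ , k′≤ , v = k′ , s≤s k′≤ , v
  ... | no disjoint = inj₂ (N ++ L , Unique.++⁺ uN uL (λ (H∈N , H∈L) → disjoint (lose H∈N H∈L)) , each , size)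
    where
    each : ∀ H → H ∈ˡ N ++ L → C H × Walk≤ H G (4 + k)
    each H H∈ with Mem.∈-++⁻ N H∈
    ... | inj₁ H∈N = proj₁ (eachN H H∈N) , towards (Near-sym (proj₂ (eachN H H∈N))) (3 + k , ≤-refl , w)
    ... | inj₂ H∈L with eachL H H∈L
    ... | cH , k′ , k′≤ , v = cH , k′ , ≤-trans k′≤ (m≤n+m (suc k) 3) , v
    size : (4 + k) * suc d ≤ 3 * length (N ++ L)
    size = begin
      (4 + k) * suc d               ≡⟨ *-distribʳ-+ (suc d) 3 (suc k) ⟩
      3 * suc d + suc k * suc d     ≤⟨ +-mono-≤ (*-monoʳ-≤ 3 sizeN) sizeL ⟩
      3 * length N + 3 * length L   ≡⟨ sym (*-distribˡ-+ 3 (length N) (length L)) ⟩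
      3 * (length N + length L)     ≡⟨ cong (3 *_) (sym (List.length-++ N)) ⟩
      3 * length (N ++ L)           ∎
      where open ≤-Reasoning

  facets-bound : ∀ L → Unique L → (∀ H → H ∈ˡ L → C H) → length L * d ! ≤ 2 * n ^ j
  facets-bound L u cL = facet-count j ⊥ L u
      (λ H H∈ → ⊥⊆ , trans (pure H (cL H H∈)) (sym (cong (_+ d) (∣⊥∣≡0 n)))) two
    where
    two : AtMostTwo L (∣ ⊥ {n} ∣ + j)
    two R ∣R∣ F F∈L R⊆F with pm R (trans ∣R∣ (cong (_+ j) (∣⊥∣≡0 n)) , F , cL F F∈L , R⊆F)
    ... | F₁ , F₂ , _ , _ , _ , _ , _ , only = F₁ , F₂ , λ G G∈L → only G (cL G G∈L)

  -- The constant 6 is 3, from taking every third facet, times 2, from `facets-bound`.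
  packing-bound : ∀ {F G k} → Packing F G k → k * d ! * (d + 1) ≤ 6 * n ^ j
  packing-bound {k = k} (L , u , each , size) = begin
    k * d ! * (d + 1)            ≡⟨ rearrange k (d !) d ⟩
    k * suc d * d !              ≤⟨ *-monoˡ-≤ (d !) (≤-trans (*-monoˡ-≤ (suc d) (n≤1+n k)) size) ⟩
    3 * length L * d !           ≡⟨ *-assoc 3 (length L) (d !) ⟩
    3 * (length L * d !)         ≤⟨ *-monoʳ-≤ 3 (facets-bound L u (λ H → proj₁ ∘ each H)) ⟩
    3 * (2 * n ^ j)              ≡⟨ sym (*-assoc 3 2 (n ^ j)) ⟩
    6 * n ^ j                    ∎
    where
    open ≤-Reasoning
    rearrange : ∀ k f d → k * f * (d + 1) ≡ k * suc d * f
    rearrange = solve-∀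

  -- Each shortening strictly lowers the length, so the process stops at a walk that carries a
  -- packing.
  short-walk : ∀ {F G k} → Acc _<ⁿ_ k → Walk C d F G k →
    ∃[ k′ ] (Walk C d F G k′ × k′ * d ! * (d + 1) ≤ 6 * n ^ j)
  short-walk {F} {G} {k} (acc rec) w with shorten-or-pack w
  ... | inj₁ (k′ , k′<k , v) = short-walk (rec k′<k) v
  ... | inj₂ packing = k , w , packing-bound {F} {G} packing

  diameter-bound : ∀ F G → C F → C G → ∃[ k ] (Walk C d F G k × k * d ! * (d + 1) ≤ 6 * n ^ j)
  diameter-bound F G cF cG =
    let k , w = proj₂ (proj₂ (proj₂ scpm)) F G cF cG in short-walk (<-wellFounded k) w

-- Stacked tubes with creation times

Labelled : ℕ → Set₁
Labelled n = Subset n → ℕ → Set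

facets : Labelled n → Complex n
facets C F = ∃[ s ] C F s

Vertex : Labelled n → Fin n → Set
Vertex C i = ∃[ F ] (facets C F × i ∈ F)

module Tubes {n : ℕ} (j : ℕ) (1≤j : 1 ≤ j) where

  TwoFacets : Labelled n → Subset n → Set
  TwoFacets C R = ∃[ F₁ ] ∃[ F₂ ] (facets C F₁ × facets C F₂ × F₁ ≢ F₂ × R ⊆ F₁ × R ⊆ F₂ ×
    (∀ G → facets C G → R ⊆ G → G ≡ F₁ ⊎ G ≡ F₂))

  -- Chains through explicit ridges, in which consecutive facets may coincide. This spares
  -- distinctness proofs while the complex changes; genuine walks are extracted at the end.
  data Linked (C : Labelled n) : Subset n → Subset n → Set where
    stop : ∀ {F} → Linked C F F
    link : ∀ {F H G} R → facets C F → facets C H → R ⊆ F → R ⊆ H → ∣ R ∣ ≡ j → Linked C H G → Linked C F G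

  -- The label of a facet is the time of its creation; the cap is the facet to be subdivided next
  -- and new is its most recent vertex.
  record Tube (C : Labelled n) (cap : Subset n) (new : Fin n) (t : ℕ) : Set where
    field
      pure      : ∀ {F s} → C F s → ∣ F ∣ ≡ suc j
      two       : ∀ R → ∣ R ∣ ≡ j → ∀ {F s} → C F s → R ⊆ F → TwoFacets C R
      cap∈      : C cap t
      new∈cap   : new ∈ cap
      label≤    : ∀ {F s} → C F s → s ≤ t
      lipschitz : ∀ {F s G s′} R → C F s → C G s′ → R ⊆ F → R ⊆ G → ∣ R ∣ ≡ j → s′ ≤ 2 + s
      -- Facets sharing a ridge with the cap date from time `t - 1` or later, and from time `t` if
      -- the ridge contains the newest vertex. This stronger invariant carries `lipschitz` through a
      -- subdivision.
      cap-label : ∀ {G s} R → C G s → R ⊆ cap → R ⊆ G → ∣ R ∣ ≡ j → t ≤ suc s × (new ∈ R → t ≤ s)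
      start     : Subset n
      start∈    : C start 0
      start≢cap : start ≢ cap
      connected : ∀ {F s} → C F s → Linked C F cap

  ∃∈≢ : ∀ {F : Subset n} → ∣ F ∣ ≡ suc j → ∀ b → ∃[ c ] (c ∈ F × c ≢ b)
  ∃∈≢ {F} ∣F∣ b with ∣∣<⇒∃∈∉ ⁅ b ⁆ F (≤-trans (s≤s (≤-trans (≤-reflexive (∣⁅x⁆∣≡1 b)) 1≤j)) (≤-reflexive (sym ∣F∣)))
  ... | c , c∈F , c∉b = c , c∈F , x∉⁅y⁆⇒x≢y c∉b

  ∣p-x∣≡ : ∀ {k} {p : Subset n} {x} → ∣ p ∣ ≡ suc k → x ∈ p → ∣ p ∖ x ∣ ≡ k
  ∣p-x∣≡ ∣p∣ x∈p = suc-injective (trans (∣p-x∣ x∈p) ∣p∣)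

  removals-distinct : ∀ {p : Subset n} {a b} → b ∈ p → a ≢ b → p ∖ a ≢ p ∖ b
  removals-distinct {p} {a} {b} b∈p a≢b eq =
    x∉p-x p b (subst (b ∈_) eq (x∈p∧x≢y⇒x∈p-y b∈p (≢-sym a≢b)))

  removed∈pair : ∀ {p : Subset n} {R a b c} → R ≡ p ∖ a ∖ b → c ∈ p → c ∉ R → c ≡ a ⊎ c ≡ b
  removed∈pair {p} {R} {a} {b} {c} eq c∈p c∉R with c Fin.≟ a | c Fin.≟ b
  ... | yes c≡a | _ = inj₁ c≡a
  ... | no _ | yes c≡b = inj₂ c≡b
  ... | no c≢a | no c≢b = contradiction
        (subst (c ∈_) (sym eq) (x∈p∧x≢y⇒x∈p-y (x∈p∧x≢y⇒x∈p-y c∈p c≢a) c≢b)) c∉R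

  codim1 : ∀ {F R : Subset n} → ∣ F ∣ ≡ suc j → R ⊆ F → ∣ R ∣ ≡ j → ∃[ b ] (b ∈ F × b ∉ R × R ≡ F ∖ b)
  codim1 {F} {R} ∣F∣ R⊆F ∣R∣
    with ∣∣<⇒∃∈∉ R F (≤-reflexive (trans (cong suc ∣R∣) (sym ∣F∣)))
  ... | b , b∈F , b∉R = b , b∈F , b∉R ,
        ⊆∧∣∣≥⇒≡ (⊆-remove R⊆F b∉R) (≤-reflexive (trans (∣p-x∣≡ ∣F∣ b∈F) (sym ∣R∣)))

  -- A facet `σ ∖ c` through `R` has `c ∉ R`, which leaves only `a` and `b`. Serves both the initial
  -- simplex and the ridges through a newly added vertex.
  pair-of-removals : ∀ {C : Labelled n} {σ R a b} → a ∈ σ → b ∈ σ → a ≢ b → a ∉ R → b ∉ R → R ⊆ σ → R ≡ σ ∖ a ∖ b →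
    facets C (σ ∖ a) → facets C (σ ∖ b) → (∀ G → facets C G → R ⊆ G → ∃[ c ] (c ∈ σ × G ≡ σ ∖ c)) → TwoFacets C R
  pair-of-removals {σ = σ} {R} {a} {b} a∈σ b∈σ a≢b a∉R b∉R R⊆σ R≡ Ca Cb removal =
    σ ∖ a , σ ∖ b , Ca , Cb , removals-distinct b∈σ a≢b , ⊆-remove R⊆σ a∉R , ⊆-remove R⊆σ b∉R , only
    where
    only : ∀ G → _ → R ⊆ G → G ≡ σ ∖ a ⊎ G ≡ σ ∖ b
    only G CG R⊆G with removal G CG R⊆G
    ... | c , c∈σ , refl with removed∈pair R≡ c∈σ (λ c∈R → x∉p-x σ c (R⊆G c∈R))
    ... | inj₁ refl = inj₁ refl
    ... | inj₂ refl = inj₂ refl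

  module Simplex (σ : Subset n) (∣σ∣ : ∣ σ ∣ ≡ 2 + j) where

    boundary : Labelled n
    boundary F s = ∃[ y ] (y ∈ σ × F ≡ σ ∖ y × s ≡ 0)

    boundary-Vertex : ∀ {i} → i ∈ σ → Vertex boundary i
    boundary-Vertex {i} i∈σ
      with ∣∣<⇒∃∈∉ ⁅ i ⁆ σ (≤-trans (s≤s (≤-reflexive (∣⁅x⁆∣≡1 i))) (≤-trans (s≤s (s≤s z≤n)) (≤-reflexive (sym ∣σ∣))))
    ... | y , y∈σ , y∉i = σ ∖ y , (0 , y , y∈σ , refl , refl) ,
          x∈p∧x≢y⇒x∈p-y i∈σ (≢-sym (x∉⁅y⁆⇒x≢y y∉i))

    boundary-tube : ∀ {y₀ new} → y₀ ∈ σ → new ∈ σ → y₀ ≢ new → Tube boundary (σ ∖ y₀) new 0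
    boundary-tube {y₀} {new} y₀∈σ new∈σ y₀≢new = record
      { pure = λ { (y , y∈σ , refl , _) → ∣p-x∣≡ ∣σ∣ y∈σ }
      ; two = two
      ; cap∈ = y₀ , y₀∈σ , refl , refl
      ; new∈cap = x∈p∧x≢y⇒x∈p-y new∈σ (≢-sym y₀≢new)
      ; label≤ = λ { (_ , _ , _ , refl) → z≤n }
      ; lipschitz = λ { _ _ (_ , _ , _ , refl) _ _ _ → z≤n }
      ; cap-label = λ _ _ _ _ _ → z≤n , λ _ → z≤n
      ; start = σ ∖ new
      ; start∈ = new , new∈σ , refl , refl
      ; start≢cap = removals-distinct y₀∈σ (≢-sym y₀≢new)
      ; connected = connected
      }
      where
      two : ∀ R → ∣ R ∣ ≡ j → ∀ {F s} → boundary F s → R ⊆ F → TwoFacets boundary R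
      two R ∣R∣ (y , y∈σ , refl , refl) R⊆F
        with codim2 R σ (λ z∈R → p-x⊆p σ y (R⊆F z∈R)) (trans (cong (2 +_) ∣R∣) (sym ∣σ∣))
      ... | a , b , a∈σ , b∈σ , a≢b , a∉R , b∉R , R≡ =
        pair-of-removals {C = boundary} a∈σ b∈σ a≢b a∉R b∉R (λ z∈R → p-x⊆p σ y (R⊆F z∈R)) R≡
          (0 , a , a∈σ , refl , refl) (0 , b , b∈σ , refl , refl)
          λ { _ (_ , c , c∈σ , G≡ , _) _ → c , c∈σ , G≡ }
      connected : ∀ {F s} → boundary F s → Linked boundary F (σ ∖ y₀)
      connected (y , y∈σ , refl , refl) with y Fin.≟ y₀
      ... | yes refl = stop
      -- Any two facets of the boundary of a simplex share a ridge, so a single link suffices.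
      ... | no y≢y₀ = link (σ ∖ y ∖ y₀) (0 , y , y∈σ , refl , refl) (0 , y₀ , y₀∈σ , refl , refl)
              (p-x⊆p (σ ∖ y) y₀)
              (⊆-remove (λ z∈ → p-x⊆p σ y (p-x⊆p (σ ∖ y) y₀ z∈)) (x∉p-x (σ ∖ y) y₀))
              (∣p-x∣≡ (∣p-x∣≡ ∣σ∣ y∈σ) (x∈p∧x≢y⇒x∈p-y y₀∈σ (≢-sym y≢y₀))) stop

  module Subdivision {C cap new t} (T : Tube C cap new t) (x : Fin n) (x∉cap : x ∉ cap) where
    open Tube T

    σ : Subset n
    σ = cap ∪ ⁅ x ⁆

    -- The stellar subdivision of `cap` at `x`: the sets `σ ∖ y` with `y ∈ cap` form the cone with
    -- apex `x` over the boundary of the removed cap.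
    subdivide : Labelled n
    subdivide G s = (C G s × G ≢ cap) ⊎ (∃[ y ] (y ∈ cap × G ≡ σ ∖ y × s ≡ suc t))

    private
      x∈σ : x ∈ σ
      x∈σ = q⊆p∪q cap ⁅ x ⁆ (x∈⁅x⁆ x)
      cap⊆σ : cap ⊆ σ
      cap⊆σ = p⊆p∪q ⁅ x ⁆
      ∣σ∣ : ∣ σ ∣ ≡ 2 + j
      ∣σ∣ = trans (∣p∪x∣ x∉cap) (cong suc (pure cap∈))
      ∈σ⇒∈cap : ∀ {y} → y ∈ σ → y ≢ x → y ∈ cap
      ∈σ⇒∈cap y∈σ y≢x with x∈p∪q⁻ cap ⁅ x ⁆ y∈σ
      ... | inj₁ y∈cap = y∈cap
      ... | inj₂ y∈x = contradiction (x∈⁅y⁆⇒x≡y x y∈x) y≢x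
      ⊆σ⇒⊆cap : ∀ {R} → R ⊆ σ → x ∉ R → R ⊆ cap
      ⊆σ⇒⊆cap R⊆σ x∉R y∈R = ∈σ⇒∈cap (R⊆σ y∈R) λ { refl → x∉R y∈R }
      ∈cap⇒≢x : ∀ {y} → y ∈ cap → y ≢ x
      ∈cap⇒≢x y∈cap refl = x∉cap y∈cap
      x∈σ-y : ∀ {y} → y ∈ cap → x ∈ σ ∖ y
      x∈σ-y y∈cap = x∈p∧x≢y⇒x∈p-y x∈σ (≢-sym (∈cap⇒≢x y∈cap))

    subdivide-Vertex : ∀ {i} → Vertex C i → Vertex subdivide i
    subdivide-Vertex {i} (F , (s , CF) , i∈F) with F ≟ˢ cap
    ... | no F≢cap = F , (s , inj₁ (CF , F≢cap)) , i∈F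
    ... | yes refl with ∃∈≢ (pure CF) i
    ... | y , y∈cap , y≢i = σ ∖ y , (suc t , inj₂ (y , y∈cap , refl , refl)) ,
          x∈p∧x≢y⇒x∈p-y (cap⊆σ i∈F) (≢-sym y≢i)

    subdivide-new-Vertex : Vertex subdivide x
    subdivide-new-Vertex = σ ∖ new , (suc t , inj₂ (new , new∈cap , refl , refl)) , x∈σ-y new∈cap

    -- `fresh` keeps the new ridges, those through `x`, out of all old facets. The next cap omits
    -- `y₀`; as `y₀ ≢ new`, it retains the previous newest vertex.
    module _ (fresh : ∀ {G s} R → C G s → R ⊆ σ → x ∈ R → ∣ R ∣ ≡ j → ¬ R ⊆ G)
             {y₀} (y₀∈cap : y₀ ∈ cap) (y₀≢new : y₀ ≢ new) where

      private
        -- An old facet `σ ∖ b` would contain the new ridge `σ ∖ b ∖ c`, contrary to `fresh`.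
        new-not-old : ∀ {b s} → b ∈ cap → ¬ C (σ ∖ b) s
        new-not-old {b} b∈cap old with ∃∈≢ (pure cap∈) b
        ... | c , c∈cap , c≢b = fresh (σ ∖ b ∖ c) old
              (λ z∈ → p-x⊆p σ b (p-x⊆p (σ ∖ b) c z∈))
              (x∈p∧x≢y⇒x∈p-y (x∈σ-y b∈cap) (≢-sym (∈cap⇒≢x c∈cap)))
              (∣p-x∣≡ (∣p-x∣≡ ∣σ∣ (cap⊆σ b∈cap)) (x∈p∧x≢y⇒x∈p-y (cap⊆σ c∈cap) c≢b))
              (p-x⊆p (σ ∖ b) c)

        cone : ∀ {y} → y ∈ cap → subdivide (σ ∖ y) (suc t)
        cone y∈cap = inj₂ (_ , y∈cap , refl , refl)

        -- If `R` is `cap ∖ b`, its facet `cap` is replaced by `σ ∖ b`, while its other facet `G₀`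
        -- survives.
        two-base : ∀ R → ∣ R ∣ ≡ j → R ⊆ cap → TwoFacets subdivide R
        two-base R ∣R∣ R⊆cap with two R ∣R∣ cap∈ R⊆cap | codim1 (pure cap∈) R⊆cap ∣R∣
        ... | F₁ , F₂ , c₁ , c₂ , F₁≢F₂ , R⊆F₁ , R⊆F₂ , only | b , b∈cap , b∉R , refl =
          other (only cap (t , cap∈) R⊆cap)
          where
          build : ∀ G₀ → facets C G₀ → G₀ ≢ cap → R ⊆ G₀ →
            (∀ G → facets C G → R ⊆ G → G ≡ cap ⊎ G ≡ G₀) → TwoFacets subdivide R
          build G₀ (s , CG₀) G₀≢cap R⊆G₀ only′ =
            G₀ , σ ∖ b , (s , inj₁ (CG₀ , G₀≢cap)) , (suc t , cone b∈cap) ,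
            (λ { refl → new-not-old b∈cap CG₀ }) , R⊆G₀ , ⊆-remove (λ z∈ → cap⊆σ (R⊆cap z∈)) b∉R , only″
            where
            only″ : ∀ G → facets subdivide G → R ⊆ G → G ≡ G₀ ⊎ G ≡ σ ∖ b
            only″ G (s′ , inj₁ (CG , G≢cap)) R⊆G with only′ G (s′ , CG) R⊆G
            ... | inj₁ G≡cap = contradiction G≡cap G≢cap
            ... | inj₂ G≡G₀ = inj₁ G≡G₀
            only″ _ (_ , inj₂ (c , c∈cap , refl , _)) R⊆G with c Fin.≟ b
            ... | yes refl = inj₂ refl
            ... | no c≢b = contradiction (R⊆G (x∈p∧x≢y⇒x∈p-y c∈cap c≢b)) (x∉p-x σ c)
          other : cap ≡ F₁ ⊎ cap ≡ F₂ → TwoFacets subdivide R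
          other (inj₁ refl) = build F₂ c₂ (≢-sym F₁≢F₂) R⊆F₂ only
          other (inj₂ refl) = build F₁ c₁ F₁≢F₂ R⊆F₁ λ G CG R⊆G → swap (only G CG R⊆G)

        -- Ridges inside `σ` that avoid `x` come from the removed cap; those containing `x` lie in
        -- cone facets only; those not inside `σ` keep their two old facets.
        two′ : ∀ R → ∣ R ∣ ≡ j → ∀ {F s} → subdivide F s → R ⊆ F → TwoFacets subdivide R
        two′ R ∣R∣ {F} {s} CF R⊆F with R ⊆? σ | x ∈? R
        ... | yes R⊆σ | no x∉R = two-base R ∣R∣ (⊆σ⇒⊆cap R⊆σ x∉R)
        ... | yes R⊆σ | yes x∈R with codim2 R σ R⊆σ (trans (cong (2 +_) ∣R∣) (sym ∣σ∣))
        ... | a , b , a∈σ , b∈σ , a≢b , a∉R , b∉R , R≡ =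
          pair-of-removals {C = subdivide} a∈σ b∈σ a≢b a∉R b∉R R⊆σ R≡
            (suc t , cone (∈σ⇒∈cap a∈σ λ { refl → a∉R x∈R }))
            (suc t , cone (∈σ⇒∈cap b∈σ λ { refl → b∉R x∈R })) removal
          where
          removal : ∀ G → facets subdivide G → R ⊆ G → ∃[ c ] (c ∈ σ × G ≡ σ ∖ c)
          removal G (_ , inj₁ (CG , _)) R⊆G = contradiction (λ {z} → R⊆G {z}) (fresh R CG R⊆σ x∈R ∣R∣)
          removal G (_ , inj₂ (c , c∈cap , G≡ , _)) _ = c , cap⊆σ c∈cap , G≡
        two′ R ∣R∣ (inj₂ (y , _ , refl , _)) R⊆F | no R⊈σ | _ = contradiction (λ {z} z∈ → p-x⊆p σ y (R⊆F {z} z∈)) R⊈σ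
        two′ R ∣R∣ (inj₁ (CF , _)) R⊆F | no R⊈σ | _ with two R ∣R∣ CF R⊆F
        ... | F₁ , F₂ , (s₁ , c₁) , (s₂ , c₂) , F₁≢F₂ , R⊆F₁ , R⊆F₂ , only =
          F₁ , F₂ , (s₁ , inj₁ (c₁ , ≢cap R⊆F₁)) , (s₂ , inj₁ (c₂ , ≢cap R⊆F₂)) , F₁≢F₂ , R⊆F₁ , R⊆F₂ , only′
          where
          ≢cap : ∀ {G} → R ⊆ G → G ≢ cap
          ≢cap R⊆G refl = R⊈σ λ z∈ → cap⊆σ (R⊆G z∈)
          only′ : ∀ G → facets subdivide G → R ⊆ G → G ≡ F₁ ⊎ G ≡ F₂
          only′ G (s , inj₁ (CG , _)) R⊆G = only G (s , CG) R⊆G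
          only′ _ (_ , inj₂ (y , _ , refl , _)) R⊆G = contradiction (λ {z} z∈ → p-x⊆p σ y (R⊆G {z} z∈)) R⊈σ

        base-ridge : ∀ {G s} R → C G s → R ⊆ σ → R ⊆ G → ∣ R ∣ ≡ j → R ⊆ cap
        base-ridge R CG R⊆σ R⊆G ∣R∣ = ⊆σ⇒⊆cap R⊆σ λ x∈R → fresh R CG R⊆σ x∈R ∣R∣ R⊆G

        lipschitz′ : ∀ {F s G s′} R → subdivide F s → subdivide G s′ → R ⊆ F → R ⊆ G → ∣ R ∣ ≡ j → s′ ≤ 2 + s
        lipschitz′ R (inj₁ (CF , _)) (inj₁ (CG , _)) R⊆F R⊆G ∣R∣ = lipschitz R CF CG R⊆F R⊆G ∣R∣
        -- The source of the constant 2: an old facet next to a cone facet shares a ridge with the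
        -- old cap, so its label is at least `t - 1`, against `suc t`.
        lipschitz′ R (inj₁ (CF , _)) (inj₂ (y , _ , refl , refl)) R⊆F R⊆G ∣R∣ =
          s≤s (proj₁ (cap-label R CF (λ {z} → base-ridge R CF (λ z∈ → p-x⊆p σ y (R⊆G z∈)) R⊆F ∣R∣ {z}) R⊆F ∣R∣))
        lipschitz′ R (inj₂ (_ , _ , _ , refl)) (inj₁ (CG , _)) R⊆F R⊆G ∣R∣ = ≤-trans (label≤ CG) (m≤n+m t 3)
        lipschitz′ R (inj₂ (_ , _ , _ , refl)) (inj₂ (_ , _ , _ , refl)) R⊆F R⊆G ∣R∣ = m≤n+m (suc t) 2

        -- A ridge shared by the new cap and an old facet is cap ∖ y₀, which contains new.
        cap-label′ : ∀ {G s} R → subdivide G s → R ⊆ σ ∖ y₀ → R ⊆ G → ∣ R ∣ ≡ j →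
          suc t ≤ suc s × (x ∈ R → suc t ≤ s)
        cap-label′ R (inj₂ (_ , _ , _ , refl)) R⊆ R⊆G ∣R∣ = n≤1+n _ , λ _ → ≤-refl
        cap-label′ {G} R (inj₁ (CG , _)) R⊆ R⊆G ∣R∣ =
          s≤s (proj₂ (cap-label R CG R⊆cap R⊆G ∣R∣) new∈R) , λ x∈R → contradiction (R⊆cap x∈R) x∉cap
          where
          R⊆cap : R ⊆ cap
          R⊆cap = base-ridge R CG (λ z∈ → p-x⊆p σ y₀ (R⊆ z∈)) R⊆G ∣R∣
          new∈R : new ∈ R
          new∈R with codim1 (pure cap∈) R⊆cap ∣R∣
          ... | b , _ , _ , refl with y₀ Fin.≟ b
          ... | yes refl = x∈p∧x≢y⇒x∈p-y new∈cap (≢-sym y₀≢new)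
          ... | no y₀≢b = contradiction (R⊆ (x∈p∧x≢y⇒x∈p-y y₀∈cap y₀≢b)) (x∉p-x σ y₀)

        link-cones : ∀ {y} → y ∈ cap → Linked subdivide (σ ∖ y) (σ ∖ y₀)
        link-cones {y} y∈cap with y Fin.≟ y₀
        ... | yes refl = stop
        ... | no y≢y₀ = link (σ ∖ y ∖ y₀) (suc t , cone y∈cap) (suc t , cone y₀∈cap)
              (p-x⊆p (σ ∖ y) y₀)
              (⊆-remove (λ z∈ → p-x⊆p σ y (p-x⊆p (σ ∖ y) y₀ z∈)) (x∉p-x (σ ∖ y) y₀))
              (∣p-x∣≡ (∣p-x∣≡ ∣σ∣ (cap⊆σ y∈cap)) (x∈p∧x≢y⇒x∈p-y (cap⊆σ y₀∈cap) (≢-sym y≢y₀))) stop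

        -- The chain is cut where it first enters the cap. The entering ridge omits some `b ∈ cap`,
        -- so it also lies in `σ ∖ b`, and the chain continues inside the cone.
        reroute : ∀ {F} → Linked C F cap → F ≢ cap → Linked subdivide F (σ ∖ y₀)
        reroute stop F≢cap = contradiction refl F≢cap
        reroute (link {H = H} R (s , CF) (s′ , CH) R⊆F R⊆H ∣R∣ rest) F≢cap with H ≟ˢ cap
        ... | no H≢cap = link R (s , inj₁ (CF , F≢cap)) (s′ , inj₁ (CH , H≢cap)) R⊆F R⊆H ∣R∣ (reroute rest H≢cap)
        ... | yes refl with codim1 (pure cap∈) R⊆H ∣R∣
        ... | b , b∈cap , b∉R , _ = link R (s , inj₁ (CF , F≢cap)) (suc t , cone b∈cap)
              R⊆F (⊆-remove (λ z∈ → cap⊆σ (R⊆H z∈)) b∉R) ∣R∣ (link-cones b∈cap)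

      subdivide-tube : Tube subdivide (σ ∖ y₀) x (suc t)
      subdivide-tube = record
        { pure = λ { (inj₁ (CF , _)) → pure CF ; (inj₂ (y , y∈cap , refl , _)) → ∣p-x∣≡ ∣σ∣ (cap⊆σ y∈cap) }
        ; two = two′
        ; cap∈ = cone y₀∈cap
        ; new∈cap = x∈σ-y y₀∈cap
        ; label≤ = λ { (inj₁ (CF , _)) → m≤n⇒m≤1+n (label≤ CF) ; (inj₂ (_ , _ , _ , refl)) → ≤-refl }
        ; lipschitz = lipschitz′
        ; cap-label = cap-label′
        ; start = start
        ; start∈ = inj₁ (start∈ , start≢cap)
        ; start≢cap = λ { refl → new-not-old y₀∈cap start∈ }
        ; connected = λ { (inj₁ (CF , F≢cap)) → reroute (connected CF) F≢cap
                        ; (inj₂ (_ , y∈cap , refl , _)) → link-cones y∈cap }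
        }

  module _ {C : Labelled n} {cap new t} (T : Tube C cap new t) where
    open Tube T

    private
      d = suc j

      adjacent : ∀ {F H R} → facets C F → facets C H → R ⊆ F → R ⊆ H → ∣ R ∣ ≡ j → F ≢ H → Adj (facets C) d F H
      adjacent {F} {H} {R} cF@(_ , CF) cH@(_ , CH) R⊆F R⊆H ∣R∣ F≢H = cF , cH , F≢H , ≤-antisym ≤j j≤
        where
        j≤ : j ≤ ∣ F ∩ H ∣
        j≤ = ≤-trans (≤-reflexive (sym ∣R∣)) (p⊆q⇒∣p∣≤∣q∣ λ x∈R → x∈p∩q⁺ (R⊆F x∈R , R⊆H x∈R))
        ≤j : ∣ F ∩ H ∣ ≤ j
        ≤j with ∣ F ∩ H ∣ ≤? j
        ... | yes ≤j = ≤j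
        ... | no ≰j = contradiction (trans
                (sym (⊆∧∣∣≥⇒≡ (p∩q⊆p F H) (≤-trans (≤-reflexive (pure CF)) (≰⇒> ≰j))))
                (⊆∧∣∣≥⇒≡ (p∩q⊆q F H) (≤-trans (≤-reflexive (pure CH)) (≰⇒> ≰j)))) F≢H

      Joined : Subset n → Subset n → Set
      Joined F G = ∃[ k ] Walk (facets C) d F G k

      to : ∀ {F G} → facets C G → Linked C F G → Joined F G
      to cG stop = 0 , here cG
      to {F} cG (link {H = H} R cF cH R⊆F R⊆H ∣R∣ rest) with F ≟ˢ H | to cG rest
      ... | yes refl | joined = joined
      ... | no F≢H | k , w = suc k , step (adjacent cF cH R⊆F R⊆H ∣R∣ F≢H) w

      -- Reverses the chain, with the walk as accumulator.
      from : ∀ {F G K} → Linked C F G → Joined F K → Joined G K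
      from stop joined = joined
      from {F} (link {H = H} R cF cH R⊆F R⊆H ∣R∣ rest) joined@(k , w) with F ≟ˢ H
      ... | yes refl = from rest joined
      ... | no F≢H = from rest (suc k , step (adjacent cH cF R⊆H R⊆F ∣R∣ (≢-sym F≢H)) w)

      join : ∀ {F G K} → Linked C F G → Joined G K → Joined F K
      join stop joined = joined
      join {F} (link {H = H} R cF cH R⊆F R⊆H ∣R∣ rest) joined with F ≟ˢ H | join rest joined
      ... | yes refl | joined′ = joined′
      ... | no F≢H | k , w = suc k , step (adjacent cF cH R⊆F R⊆H ∣R∣ F≢H) w

    tube-SCPM : (∀ i → Vertex C i) → IsSCPM n d (facets C)
    tube-SCPM vertices =
        (λ _ (_ , CF) → pure CF)
      , vertices
      , (λ { R (∣R∣ , F , (_ , CF) , R⊆F) → two R ∣R∣ CF R⊆F })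
      , λ F G cF@(_ , CF) cG@(_ , CG) → join (connected CF) (from (connected CG) (0 , here cG))

    walk-label : ∀ {F G k s} → Walk (facets C) d F G k → C F s → ∃[ s′ ] (C G s′ × s′ ≤ s + 2 * k)
    walk-label {s = s} (here _) CF = s , CF , ≤-reflexive (sym (+-identityʳ s))
    walk-label {F} {k = suc k} {s} (step {H = H} (_ , (s₁ , CH) , _ , ∣F∩H∣) w) CF with walk-label w CH
    ... | s′ , CG , s′≤ = s′ , CG , ≤-trans s′≤ (≤-trans
            (+-monoˡ-≤ (2 * k) (lipschitz (F ∩ H) CF CH (p∩q⊆p F H) (p∩q⊆q F H) ∣F∩H∣))
            (≤-reflexive (shift s k)))
      where
      shift : ∀ s k → 2 + s + 2 * k ≡ s + 2 * suc k
      shift = solve-∀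

    -- The walk yields some label `s′ ≤ 2 * k` of the cap. Applying `cap-label` to the cap itself,
    -- with a ridge through `new`, gives `t ≤ s′`.
    tube-length : ∀ {k} → Walk (facets C) d start cap k → t ≤ 2 * k
    tube-length w with walk-label w start∈ | ∃∈≢ {F = cap} (pure cap∈) new
    ... | s′ , Ccap , s′≤ | y , y∈cap , y≢new = ≤-trans
          (proj₂ (cap-label (cap ∖ y) Ccap (p-x⊆p cap y) (p-x⊆p cap y) (∣p-x∣≡ {p = cap} (pure cap∈) y∈cap))
            (x∈p∧x≢y⇒x∈p-y new∈cap (≢-sym y≢new))) s′≤

-- Lists of letters as vertex sets

_∈ˡ?_ : (x : Fin n) (xs : List (Fin n)) → Dec (x ∈ˡ xs)
_∈ˡ?_ = DecMem._∈?_ Fin._≟_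

∈-take⁻ : ∀ {x : A} k xs → x ∈ˡ take k xs → x ∈ˡ xs
∈-take⁻ (suc k) (_ ∷ xs) (here eq) = here eq
∈-take⁻ (suc k) (_ ∷ xs) (there x∈) = there (∈-take⁻ k xs x∈)

∈-take-mono : ∀ {x : A} {k l} xs → k ≤ l → x ∈ˡ take k xs → x ∈ˡ take l xs
∈-take-mono (_ ∷ xs) (s≤s k≤l) (here eq) = here eq
∈-take-mono (_ ∷ xs) (s≤s k≤l) (there x∈) = there (∈-take-mono xs k≤l x∈)

∈-drop⁻ : ∀ {x : A} k xs → x ∈ˡ drop k xs → x ∈ˡ xs
∈-drop⁻ zero xs x∈ = x∈
∈-drop⁻ (suc k) (_ ∷ xs) x∈ = there (∈-drop⁻ k xs x∈)

take-snoc : ∀ k (xs : List A) → k <ⁿ length xs → ∃[ y ] take (suc k) xs ≡ take k xs ++ y ∷ []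
take-snoc zero (x ∷ xs) _ = x , refl
take-snoc (suc k) (x ∷ xs) (s≤s k<) with take-snoc k xs k<
... | y , eq = y , cong (x ∷_) eq

fromList : List (Fin n) → Subset n
fromList [] = ⊥
fromList (x ∷ xs) = fromList xs ∪ ⁅ x ⁆

∈-fromList⁺ : ∀ {x : Fin n} {xs} → x ∈ˡ xs → x ∈ fromList xs
∈-fromList⁺ {x = x} {_ ∷ xs} (here refl) = q⊆p∪q (fromList xs) ⁅ x ⁆ (x∈⁅x⁆ x)
∈-fromList⁺ {xs = y ∷ xs} (there x∈) = p⊆p∪q ⁅ y ⁆ (∈-fromList⁺ x∈)

∈-fromList⁻ : ∀ {x : Fin n} xs → x ∈ fromList xs → x ∈ˡ xs
∈-fromList⁻ [] x∈ = contradiction x∈ ∉⊥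
∈-fromList⁻ (y ∷ xs) x∈ with x∈p∪q⁻ (fromList xs) ⁅ y ⁆ x∈
... | inj₁ x∈xs = there (∈-fromList⁻ xs x∈xs)
... | inj₂ x∈y = here (x∈⁅y⁆⇒x≡y y x∈y)

∣fromList∣ : ∀ {xs : List (Fin n)} → Unique xs → ∣ fromList xs ∣ ≡ length xs
∣fromList∣ {n} [] = ∣⊥∣≡0 n
∣fromList∣ {xs = x ∷ xs} (x∉xs ∷ u) =
  trans (∣p∪x∣ λ x∈ → All.lookup x∉xs (∈-fromList⁻ xs x∈) refl) (cong suc (∣fromList∣ u))

fromList-snoc : ∀ (xs : List (Fin n)) y → Unique (xs ++ y ∷ []) → y ∉ˡ xs × fromList (xs ++ y ∷ []) ∖ y ≡ fromList xs
fromList-snoc xs y u = y∉xs , ⊆-antisym ⊆ˡ ⊆ʳ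
  where
  distinct : ∀ xs → Unique (xs ++ y ∷ []) → y ∉ˡ xs
  distinct (x ∷ xs) (x∉ ∷ _) (here refl) = All.lookup x∉ (Mem.∈-++⁺ʳ xs (here refl)) refl
  distinct (x ∷ xs) (_ ∷ u) (there y∈) = distinct xs u y∈
  y∉xs = distinct xs u
  ⊆ˡ : fromList (xs ++ y ∷ []) ∖ y ⊆ fromList xs
  ⊆ˡ z∈ with Mem.∈-++⁻ xs (∈-fromList⁻ (xs ++ y ∷ []) (p-x⊆p _ y z∈))
  ... | inj₁ z∈xs = ∈-fromList⁺ z∈xs
  ... | inj₂ (here refl) = contradiction z∈ (x∉p-x _ y)
  ⊆ʳ : fromList xs ⊆ fromList (xs ++ y ∷ []) ∖ y
  ⊆ʳ z∈ = x∈p∧x≢y⇒x∈p-y (∈-fromList⁺ (Mem.∈-++⁺ˡ (∈-fromList⁻ xs z∈))) λ { refl → y∉xs (∈-fromList⁻ xs z∈) }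

picks : List A → List (A × List A)
picks [] = []
picks (x ∷ xs) = (x , xs) ∷ map (λ (y , ys) → y , x ∷ ys) (picks xs)

∈-picks⁺ : ∀ {x : A} {xs} → x ∈ˡ xs → ∃[ ys ] ((x , ys) ∈ˡ picks xs × (∀ {y} → y ∈ˡ xs → y ≢ x → y ∈ˡ ys))
∈-picks⁺ {x = x} {_ ∷ xs} (here refl) = xs , here refl , λ
  { (here y≡x) y≢x → contradiction y≡x y≢x ; (there y∈) _ → y∈ }
∈-picks⁺ {xs = z ∷ xs} (there x∈) with ∈-picks⁺ x∈
... | ys , p∈ , rest = z ∷ ys , there (Mem.∈-map⁺ _ p∈) , λ
  { (here y≡z) _ → here y≡z ; (there y∈) y≢x → there (rest y∈ y≢x) }

length-picks : ∀ (xs : List A) → length (picks xs) ≡ length xs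
length-picks [] = refl
length-picks (x ∷ xs) = cong suc (trans (List.length-map _ (picks xs)) (length-picks xs))

∈-picks⁻ : ∀ (xs : List A) {x ys} → (x , ys) ∈ˡ picks xs → x ∈ˡ xs × suc (length ys) ≡ length xs
∈-picks⁻ (_ ∷ xs) (here refl) = here refl , refl
∈-picks⁻ (_ ∷ xs) (there p∈) with Mem.∈-map⁻ _ p∈
... | _ , q∈ , refl with ∈-picks⁻ xs q∈
... | x∈ , eq = there x∈ , cong suc eq

prefixed : List (A × List A) → (List A → List (List A)) → List (List A)
prefixed ps g = concatMap (λ (x , ys) → map (x ∷_) (g ys)) ps

∈-prefixed⁺ : ∀ {ps g} {x : A} {ys w} → (x , ys) ∈ˡ ps → w ∈ˡ g ys → x ∷ w ∈ˡ prefixed ps g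
∈-prefixed⁺ {x = x} p∈ w∈ = Mem.∈-concatMap⁺ _ (Any.map (λ { refl → Mem.∈-map⁺ (x ∷_) w∈ }) p∈)

∈-prefixed⁻ : ∀ ps g {x : A} {w} → x ∷ w ∈ˡ prefixed ps g → ∃[ ys ] (x , ys) ∈ˡ ps
∈-prefixed⁻ ps g w∈ with find (Mem.∈-concatMap⁻ _ {xs = ps} w∈)
... | (x , ys) , p∈ , xw∈ with Mem.∈-map⁻ (x ∷_) xw∈
... | _ , _ , refl = ys , p∈

-- Good words and their conflicts

module Words (n m : ℕ) where

  d : ℕ
  d = 2 + m

  Word : Set
  Word = List (Fin n)

  free : Word → List (Fin n × Word)
  free l = map (_, l) (allFin n)

  -- Words with k letters drawn from l without repetition and f unconstrained letters, in any order.
  fill : ℕ → ℕ → Word → List Word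
  fill zero zero l = [] ∷ []
  fill (suc k) zero l = prefixed (picks l) (fill k zero)
  fill zero (suc f) l = prefixed (free l) (fill zero f)
  fill (suc k) (suc f) l = prefixed (picks l) (fill k (suc f)) ++ prefixed (free l) (fill (suc k) f)

  hits : Word → Word → ℕ
  hits l z = length (filter (_∈ˡ? l) z)

  hits-mono : ∀ {l l′ z} → Unique z → (∀ {y} → y ∈ˡ z → y ∈ˡ l → y ∈ˡ l′) → hits l z ≤ hits l′ z
  hits-mono {l} {l′} {z} u l⊆l′ = unique⇒length≤ (Unique.filter⁺ (_∈ˡ? l) u) λ y∈ →
    let y∈z , y∈l = Mem.∈-filter⁻ (_∈ˡ? l) {xs = z} y∈ in Mem.∈-filter⁺ (_∈ˡ? l′) y∈z (l⊆l′ y∈z y∈l)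

  hits≤length : ∀ l z → hits l z ≤ length z
  hits≤length l z = List.length-filter (_∈ˡ? l) z

  ∈-free : ∀ a l → (a , l) ∈ˡ free l
  ∈-free a l = Mem.∈-map⁺ (_, l) (Mem.∈-allFin a)

  -- Greedy: while `k` is positive, a head found in `l` counts as drawn, and deleting it from `l`
  -- costs the tail of `z` no hit because `z` has no repetition. Other heads are free; with `f` zero
  -- such a head would leave too few letters for `k` hits.
  ∈-fill : ∀ k f l z → Unique z → length z ≡ k + f → k ≤ hits l z → z ∈ˡ fill k f l
  ∈-fill zero zero l [] _ _ _ = here refl
  ∈-fill zero (suc f) l (a ∷ z) (_ ∷ u) len _ =
    ∈-prefixed⁺ (∈-free a l) (∈-fill zero f l z u (suc-injective len) z≤n)
  ∈-fill (suc k) f l (a ∷ z) (a∉z ∷ u) len k≤ with a ∈ˡ? l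
  ∈-fill (suc k) zero l (a ∷ z) (a∉z ∷ u) len k≤ | no _ =
    contradiction (≤-trans k≤ (hits≤length l z)) (<⇒≱ (s≤s (≤-reflexive (trans (suc-injective len) (+-identityʳ k)))))
  ∈-fill (suc k) (suc f) l (a ∷ z) (a∉z ∷ u) len k≤ | no _ =
    Mem.∈-++⁺ʳ (prefixed (picks l) (fill k (suc f)))
      (∈-prefixed⁺ (∈-free a l) (∈-fill (suc k) f l z u (trans (suc-injective len) (+-suc k f)) k≤))
  ∈-fill (suc k) f l (a ∷ z) (a∉z ∷ u) len (s≤s k≤) | yes a∈l with ∈-picks⁺ a∈l
  ∈-fill (suc k) zero l (a ∷ z) (a∉z ∷ u) len (s≤s k≤) | yes a∈l | r , p∈ , rest =
    ∈-prefixed⁺ p∈ (∈-fill k zero r z u (suc-injective len)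
      (≤-trans k≤ (hits-mono u λ y∈z y∈l → rest y∈l λ { refl → All.lookup a∉z y∈z refl })))
  ∈-fill (suc k) (suc f) l (a ∷ z) (a∉z ∷ u) len (s≤s k≤) | yes a∈l | r , p∈ , rest =
    Mem.∈-++⁺ˡ (∈-prefixed⁺ p∈ (∈-fill k (suc f) r z u (suc-injective len)
      (≤-trans k≤ (hits-mono u λ y∈z y∈l → rest y∈l λ { refl → All.lookup a∉z y∈z refl }))))

  -- Words z of length d + 1 whose head and m further letters lie in a window of the given word.
  windowConflicts : Word → List Word
  windowConflicts l = prefixed (picks l) (fill m 2)

  conflicts : Word → List Word
  conflicts [] = []
  conflicts w@(_ ∷ v) = windowConflicts (take (suc d) w) ++ conflicts v

  -- `x ∷ take d w` lists the vertices of the simplex added by `x`.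
  Extends : Fin n → Word → Set
  Extends x w = x ∉ˡ take (2 * d) w × x ∷ take d w ∉ˡ conflicts (drop d w)

  -- Words are read from their most recent letter. Forbidding the last 2d letters leaves only
  -- conflicts with windows disjoint from the last d letters.
  Good : Word → Set
  Good [] = 0 ≤ 0
  Good (x ∷ w) = Good w × Extends x w

  ∈-conflicts : ∀ {z} i w → z ∈ˡ windowConflicts (take (suc d) (drop i w)) → z ∈ˡ conflicts w
  ∈-conflicts zero (_ ∷ _) z∈ = Mem.∈-++⁺ˡ z∈
  ∈-conflicts (suc i) (x ∷ w) z∈ = Mem.∈-++⁺ʳ (windowConflicts (take (suc d) (x ∷ w))) (∈-conflicts i w z∈)

  conflicts-head : ∀ {x z} w → x ∷ z ∈ˡ conflicts w → x ∈ˡ w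
  conflicts-head (y ∷ v) z∈ with Mem.∈-++⁻ (windowConflicts (take (suc d) (y ∷ v))) z∈
  ... | inj₁ z∈ˡ = ∈-take⁻ (suc d) (y ∷ v)
        (proj₁ (∈-picks⁻ _ (proj₂ (∈-prefixed⁻ (picks (take (suc d) (y ∷ v))) (fill m 2) z∈ˡ))))
  ... | inj₂ z∈ʳ = there (conflicts-head v z∈ʳ)

  Good-fresh : ∀ {x w} → Good w → x ∉ˡ w → Good (x ∷ w)
  Good-fresh {w = w} good x∉w = good , x∉w ∘ ∈-take⁻ (2 * d) w , x∉w ∘ ∈-drop⁻ d w ∘ conflicts-head (drop d w)

  complete : ∀ xs w → Good w → ∃[ v ] (Good v × length w ≤ length v × (∀ {x} → x ∈ˡ xs ⊎ x ∈ˡ w → x ∈ˡ v))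
  complete [] w good = w , good , ≤-refl , λ { (inj₁ ()) ; (inj₂ x∈) → x∈ }
  complete (y ∷ xs) w good with complete xs w good
  ... | v , good′ , w≤v , covers with y ∈ˡ? v
  ... | yes y∈v = v , good′ , w≤v , λ
        { (inj₁ (here refl)) → y∈v ; (inj₁ (there x∈)) → covers (inj₁ x∈) ; (inj₂ x∈) → covers (inj₂ x∈) }
  ... | no y∉v = y ∷ v , Good-fresh good′ y∉v , m≤n⇒m≤1+n w≤v , λ
        { (inj₁ (here refl)) → here refl ; (inj₁ (there x∈)) → there (covers (inj₁ x∈)) ; (inj₂ x∈) → there (covers (inj₂ x∈)) }

  Good-unique : ∀ k w → k ≤ suc (2 * d) → Good w → Unique (take k w)
  Good-unique zero w _ _ = []
  Good-unique (suc k) [] _ _ = []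
  Good-unique (suc k) (x ∷ w) (s≤s k≤) (good , x∉ , _) =
    All.tabulate (λ { y∈ refl → x∉ (∈-take-mono w k≤ y∈) }) ∷ Good-unique k w (m≤n⇒m≤1+n k≤) good

  -- Finds the vertex opposite to the next cap: `y` leaves the last `d + 1` letters, and the last
  -- `d` remain.
  oldest : ∀ w → d <ⁿ length w → Good w →
    ∃[ y ] (y ∈ˡ take (suc d) w × y ∉ˡ take d w × fromList (take (suc d) w) ∖ y ≡ fromList (take d w))
  oldest w d< good with take-snoc d w d<
  ... | y , eq = y ,
        subst (y ∈ˡ_) (sym eq) (Mem.∈-++⁺ʳ (take d w) (here refl)) ,
        proj₁ snoc , trans (cong (λ l → fromList l ∖ y) eq) (proj₂ snoc)
    where
    snoc = fromList-snoc (take d w) y (subst Unique eq (Good-unique (suc d) w (s≤s (m≤m+n d (d + 0))) good))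

  -- The tube of a good word

  open Tubes {n} (suc m) (s≤s z≤n)

  -- The invariant that connects facets with words: every facet lies among `d + 1` consecutive
  -- letters.
  InWindow : Word → Subset n → Set
  InWindow w F = ∃[ i ] F ⊆ fromList (take (suc d) (drop i w))

  module Extension {x w} (good : Good w) (ext : Extends x w) (d≤ : d ≤ length w) where

    -- `x` is picked from `l` first; the other `m` vertices of `R` are the required hits in
    -- `take d w`, whose two remaining letters are free.
    conflict : ∀ {R} l → R ⊆ fromList (x ∷ take d w) → x ∈ R → ∣ R ∣ ≡ suc m → R ⊆ fromList l → x ∷ take d w ∈ˡ windowConflicts l
    conflict {R} l R⊆z x∈R ∣R∣ R⊆l with ∈-picks⁺ (∈-fromList⁻ l (R⊆l x∈R))
    ... | r , p∈ , rest = ∈-prefixed⁺ p∈ (∈-fill m 2 r (take d w)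
            (Good-unique d w (m≤n⇒m≤1+n (m≤m+n d (d + 0))) good)
            (trans (List.length-take d w) (trans (m≤n⇒m⊓n≡m d≤) (+-comm 2 m)))
            (≤-trans (≤-reflexive (suc-injective (trans (sym ∣R∣) (sym (∣p-x∣ x∈R)))))
              (covered⇒∣∣≤length (R ∖ x) _ λ y∈ →
                let y∈R = p-x⊆p R x y∈ ; y≢x = x∈p-y⇒x≢y R y∈ in
                Mem.∈-filter⁺ (_∈ˡ? r) (tail (∈-fromList⁻ (x ∷ take d w) (R⊆z y∈R)) y≢x) (rest (∈-fromList⁻ l (R⊆l y∈R)) y≢x))))
      where
      tail : ∀ {y} → y ∈ˡ x ∷ take d w → y ≢ x → y ∈ˡ take d w
      tail (here y≡x) y≢x = contradiction y≡x y≢x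
      tail (there y∈) _ = y∈

    -- A window starting at depth `d` or more is excluded by the absence of conflicts. A more recent
    -- one lies within the last `2 * d` letters, where `x` does not occur.
    fresh : ∀ {G} R → InWindow w G → R ⊆ fromList (x ∷ take d w) → x ∈ R → ∣ R ∣ ≡ suc m → ¬ R ⊆ G
    fresh R (i , G⊆) R⊆z x∈R ∣R∣ R⊆G with d ≤? i
    ... | yes d≤i = proj₂ ext (∈-conflicts (i ∸ d) (drop d w)
            (conflict (take (suc d) (drop (i ∸ d) (drop d w))) R⊆z x∈R ∣R∣ λ y∈R →
              subst (λ v → _ ∈ fromList (take (suc d) v))
                (sym (trans (List.drop-drop d (i ∸ d) w) (cong (λ k → drop k w) (m+[n∸m]≡n d≤i)))) (G⊆ (R⊆G y∈R))))
    ... | no d≰i = proj₁ ext (∈-take-mono w i+d+1≤2d (∈-drop⁻ i (take (i + suc d) w)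
            (subst (x ∈ˡ_) (List.take-drop (suc d) i w) (∈-fromList⁻ _ (G⊆ (R⊆G x∈R))))))
      where
      i+d+1≤2d : i + suc d ≤ 2 * d
      i+d+1≤2d = ≤-trans (≤-reflexive (+-suc i d)) (≤-trans (+-monoˡ-≤ d (≰⇒> d≰i))
        (+-monoʳ-≤ d (≤-reflexive (sym (+-identityʳ d)))))

  -- The clause for `[]` is a default value, as a tube has a newest letter.
  WordTube : ℕ → Word → Set₁
  WordTube t [] = Labelled n
  WordTube t w@(x ∷ _) = ∃[ C ] (Tube C (fromList (take d w)) x t ×
    (∀ {G s} → C G s → InWindow w G) × (∀ {i} → i ∈ˡ w → Vertex C i))

  -- Of the `suc (t + d)` letters, `suc d` span the initial simplex and each of the other `t` is one
  -- subdivision.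
  word-tube : ∀ t x w → length w ≡ t + d → Good (x ∷ w) → WordTube t (x ∷ w)
  word-tube zero x w len good@(good-w , _) with oldest (x ∷ w) (s≤s (≤-reflexive (sym len))) good
  ... | y , y∈ , y∉ , eq = Simplex.boundary σ ∣σ∣ ,
        subst (λ cap → Tube (Simplex.boundary σ ∣σ∣) cap x 0) eq
          (Simplex.boundary-tube σ ∣σ∣ (∈-fromList⁺ y∈) (∈-fromList⁺ {xs = x ∷ take d w} (here refl)) λ { refl → y∉ (here refl) }) ,
        (λ { (z , _ , refl , _) → 0 , p-x⊆p σ z }) ,
        λ {i} i∈ → Simplex.boundary-Vertex σ ∣σ∣ (∈-fromList⁺ (subst (i ∈ˡ_) (sym all) i∈))
    where
    σ = fromList (take (suc d) (x ∷ w))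
    all : take (suc d) (x ∷ w) ≡ x ∷ w
    all = List.take-all (suc d) (x ∷ w) (s≤s (≤-reflexive len))
    ∣σ∣ : ∣ σ ∣ ≡ suc d
    ∣σ∣ = trans (∣fromList∣ (Good-unique (suc d) (x ∷ w) (s≤s (m≤m+n d (d + 0))) good)) (trans (cong length all) (cong suc len))
  word-tube (suc t) x w@(x′ ∷ v) len good@(good-w , ext@(x∉ , _)) with word-tube t x′ v (suc-injective len) good-w
  ... | C , T , inWindow , vertex with oldest (x ∷ w) (m≤n⇒m≤1+n (≤-trans (s≤s (m≤n+m d t)) (≤-reflexive (sym len)))) good
  ... | y , y∈ , y∉ , eq = S.subdivide ,
        subst (λ cap → Tube S.subdivide cap x (suc t)) eq
          (S.subdivide-tube (λ R CG → Extension.fresh good-w ext d≤ R (inWindow CG)) (∈-fromList⁺ (y∈take y∈)) λ { refl → y∉ (there (here refl)) }) ,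
        inWindow′ , vertex′
    where
    d≤ : d ≤ length w
    d≤ = ≤-trans (m≤n+m d (suc t)) (≤-reflexive (sym len))
    x∉cap : x ∉ fromList (take d w)
    x∉cap x∈ = x∉ (∈-take-mono w (m≤m+n d (d + 0)) (∈-fromList⁻ (take d w) x∈))
    module S = Subdivision T x x∉cap
    y∈take : y ∈ˡ x ∷ take d w → y ∈ˡ take d w
    y∈take (here refl) = contradiction (here refl) y∉
    y∈take (there y∈w) = y∈w
    inWindow′ : ∀ {G s} → S.subdivide G s → InWindow (x ∷ w) G
    inWindow′ (inj₁ (CG , _)) = let i , G⊆ = inWindow CG in suc i , G⊆
    inWindow′ (inj₂ (z , _ , refl , _)) = 0 , p-x⊆p _ z
    vertex′ : ∀ {i} → i ∈ˡ x ∷ w → Vertex S.subdivide i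
    vertex′ (here refl) = S.subdivide-new-Vertex
    vertex′ (there i∈) = S.subdivide-Vertex (vertex i∈)

  word-pseudomanifold : ∀ t w → length w ≡ suc (t + d) → Good w → (∀ i → i ∈ˡ w) →
    ∃[ C ] (IsSCPM n d C × ∃[ F ] ∃[ G ] (C F × C G × (∀ k → Walk C d F G k → t ≤ 2 * k)))
  word-pseudomanifold t (x ∷ w) len good covers with word-tube t x w (suc-injective len) good
  ... | C , T , _ , vertex = facets C , tube-SCPM T (λ i → vertex (covers i)) ,
        Tube.start T , _ , (_ , Tube.start∈ T) , (_ , Tube.cap∈ T) , λ _ → tube-length T

-- Counting good words

-- The factor `k` carries denominators, so that bounds such as half a factorial stay in `ℕ`.
length-concatMap : ∀ k c {f : A → List B} xs → (∀ {x} → x ∈ˡ xs → k * length (f x) ≤ c) →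
  k * length (concatMap f xs) ≤ length xs * c
length-concatMap k c [] _ = ≤-reflexive (*-zeroʳ k)
length-concatMap k c {f} (x ∷ xs) each = begin
  k * length (f x ++ concatMap f xs)              ≡⟨ cong (k *_) (List.length-++ (f x)) ⟩
  k * (length (f x) + length (concatMap f xs))    ≡⟨ *-distribˡ-+ k (length (f x)) _ ⟩
  k * length (f x) + k * length (concatMap f xs)  ≤⟨ +-mono-≤ (each (here refl)) (length-concatMap k c xs (each ∘ there)) ⟩
  c + length xs * c                               ∎
  where open ≤-Reasoning

length-prefixed : ∀ k c (ps : List (A × List A)) g → (∀ {x ys} → (x , ys) ∈ˡ ps → k * length (g ys) ≤ c) →
  k * length (prefixed ps g) ≤ length ps * c
length-prefixed k c ps g each = length-concatMap k c ps λ {(x , ys)} p∈ →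
  ≤-trans (≤-reflexive (cong (k *_) (List.length-map (x ∷_) (g ys)))) (each p∈)

length-cartesianProductWith : ∀ {A B C : Set} (f : A → B → C) xs ys → length (cartesianProductWith f xs ys) ≡ length xs * length ys
length-cartesianProductWith f [] ys = refl
length-cartesianProductWith f (x ∷ xs) ys = trans (List.length-++ (map (f x) ys))
  (cong₂ _+_ (List.length-map (f x) ys) (length-cartesianProductWith f xs ys))

module Counting (n m : ℕ) where
  open Words n m

  length-free : ∀ l → length (free l) ≡ n
  length-free l = trans (List.length-map _ (allFin n)) (List.length-tabulate {n = n} id)

  picked-prefix : ∀ k c {b} (l : Word) (g : Word → List Word) → length l ≤ suc b → (∀ ys → length ys ≤ b → k * length (g ys) ≤ c) →
    k * length (prefixed (picks l) g) ≤ suc b * c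
  picked-prefix k c {b} l g l≤ each = ≤-trans
    (length-prefixed k c (picks l) g λ {_} {ys} p∈ →
      each ys (≤-pred (≤-trans (≤-reflexive (proj₂ (∈-picks⁻ l p∈))) l≤)))
    (*-monoˡ-≤ c (≤-trans (≤-reflexive (length-picks l)) l≤))

  free-prefix : ∀ k c l g → k * length (g l) ≤ c → k * length (prefixed (free l) g) ≤ n * c
  free-prefix k c l g bound = ≤-trans
    (length-prefixed k c (free l) g λ p∈ → ≤-trans (≤-reflexive (cong (λ ys → k * length (g ys)) (rest p∈))) bound)
    (≤-reflexive (cong (_* c) (length-free l)))
    where
    rest : ∀ {x ys} → (x , ys) ∈ˡ free l → ys ≡ l
    rest p∈ with Mem.∈-map⁻ (_, l) p∈
    ... | _ , _ , refl = refl

  split : ∀ k {a b} (xs ys : List Word) → k * length xs ≤ a → k * length ys ≤ b → k * length (xs ++ ys) ≤ a + b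
  split k xs ys xs≤ ys≤ = ≤-trans
    (≤-reflexive (trans (cong (k *_) (List.length-++ xs)) (*-distribˡ-+ k (length xs) _))) (+-mono-≤ xs≤ ys≤)

  -- An ordered choice of `k` among `k + 2` letters: `(2 + k) ! / 2` ways.
  length-fill₀ : ∀ k l → length l ≤ 2 + k → 2 * length (fill k 0 l) ≤ (2 + k) !
  length-fill₀ zero l l≤ = ≤-refl
  length-fill₀ (suc k) l l≤ = picked-prefix 2 ((2 + k) !) l (fill k 0) l≤ (length-fill₀ k)

  length-fill₁ : ∀ k l → length l ≤ 2 + k → 2 * length (fill k 1 l) ≤ (1 + k) * n * (2 + k) !
  length-fill₁ zero l l≤ = ≤-trans (free-prefix 2 2 l (fill 0 0) ≤-refl) (≤-reflexive (cong (_* 2) (sym (+-identityʳ n))))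
  length-fill₁ (suc k) l l≤ = ≤-trans
    (split 2 (prefixed (picks l) (fill k 1)) (prefixed (free l) (fill (suc k) 0))
      (picked-prefix 2 _ l (fill k 1) l≤ (length-fill₁ k))
      (free-prefix 2 ((3 + k) !) l (fill (suc k) 0) (length-fill₀ (suc k) l l≤)))
    (≤-reflexive (collect k n ((2 + k) !)))
    where
    collect : ∀ k n F → (3 + k) * ((1 + k) * n * F) + n * ((3 + k) * F) ≡ (2 + k) * n * ((3 + k) * F)
    collect = solve-∀

  -- `(1 + k) * (2 + k) / 2` positions for the two free letters, `n * n` values for them, and
  -- `(2 + k) ! / 2` choices of the drawn ones.
  length-fill₂ : ∀ k l → length l ≤ 2 + k → 4 * length (fill k 2 l) ≤ (1 + k) * (2 + k) * (n * n) * (2 + k) !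
  length-fill₂ zero l l≤ = ≤-trans
    (free-prefix 4 (4 * n) l (fill 0 1)
      (≤-trans (≤-reflexive (*-assoc 2 2 (length (fill 0 1 l))))
        (≤-trans (*-monoʳ-≤ 2 (length-fill₁ 0 l l≤)) (≤-reflexive (simplify n)))))
    (≤-reflexive (collect n))
    where
    simplify : ∀ n → 2 * (1 * n * 2) ≡ 4 * n
    simplify = solve-∀
    collect : ∀ n → n * (4 * n) ≡ 1 * 2 * (n * n) * 2
    collect = solve-∀
  length-fill₂ (suc k) l l≤ = ≤-trans
    (split 4 (prefixed (picks l) (fill k 2)) (prefixed (free l) (fill (suc k) 1))
      (picked-prefix 4 _ l (fill k 2) l≤ (length-fill₂ k))
      (free-prefix 4 (2 * ((2 + k) * n * (3 + k) !)) l (fill (suc k) 1)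
        (≤-trans (≤-reflexive (*-assoc 2 2 (length (fill (suc k) 1 l)))) (*-monoʳ-≤ 2 (length-fill₁ (suc k) l l≤)))))
    (≤-reflexive (collect k n ((2 + k) !)))
    where
    collect : ∀ k n F → (3 + k) * ((1 + k) * (2 + k) * (n * n) * F) + n * (2 * ((2 + k) * n * ((3 + k) * F)))
      ≡ (2 + k) * (3 + k) * (n * n) * ((3 + k) * F)
    collect = solve-∀

  -- A quarter of κ bounds the number of conflicts caused by one window.
  κ : ℕ
  κ = suc d * ((1 + m) * d * (n * n) * d !)

  length-conflicts : ∀ w → 4 * length (conflicts w) ≤ length w * κ
  length-conflicts [] = z≤n
  length-conflicts w@(x ∷ v) = split 4 (windowConflicts (take (suc d) w)) (conflicts v)
    (picked-prefix 4 _ (take (suc d) w) (fill m 2)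
      (≤-trans (≤-reflexive (List.length-take (suc d) w)) (m⊓n≤m (suc d) (length w)))
      (length-fill₂ m))
    (length-conflicts v)

  good? : ∀ w → Dec (Good w)
  good? [] = yes z≤n
  good? (x ∷ w) = good? w ×-dec (¬? (x ∈ˡ? take (2 * d) w) ×-dec
    ¬? (DecMem._∈?_ (List.≡-dec Fin._≟_) (x ∷ take d w) (conflicts (drop d w))))

  candidates words : ℕ → List Word
  candidates t = cartesianProductWith _∷_ (allFin n) (words t)
  words zero = [] ∷ []
  words (suc t) = filter good? (candidates t)

  candidates-unique : ∀ t → Unique (candidates t)
  words-unique : ∀ t → Unique (words t)
  candidates-unique t = Unique.cartesianProductWith⁺ _∷_ List.∷-injective (Unique.allFin⁺ n) (words-unique t)
  words-unique zero = [] ∷ []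
  words-unique (suc t) = Unique.filter⁺ good? (candidates-unique t)

  ∈-words⁻ : ∀ t {x w} → x ∷ w ∈ˡ words (suc t) → w ∈ˡ words t × Good (x ∷ w)
  ∈-words⁻ t {x} {w} xw∈ with Mem.∈-filter⁻ good? {xs = candidates t} xw∈
  ... | xw∈c , good with Mem.∈-cartesianProductWith⁻ _∷_ (allFin n) (words t) xw∈c
  ... | _ , _ , _ , w∈ , refl = w∈ , good

  words-good : ∀ t {w} → w ∈ˡ words t → Good w × length w ≡ t
  words-good zero (here refl) = z≤n , refl
  words-good (suc t) {[]} w∈ with Mem.∈-cartesianProductWith⁻ _∷_ (allFin n) (words t) (proj₁ (Mem.∈-filter⁻ good? {xs = candidates t} w∈))
  ... | _ , _ , _ , _ , ()
  words-good (suc t) {x ∷ w} w∈ = let w∈′ , good = ∈-words⁻ t w∈ in good , cong suc (proj₂ (words-good t w∈′))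

  drop-words : ∀ k s {w} → w ∈ˡ words (k + s) → drop k w ∈ˡ words s
  drop-words zero s w∈ = w∈
  drop-words (suc k) s {[]} w∈ = contradiction (proj₂ (words-good (suc (k + s)) w∈)) λ ()
  drop-words (suc k) s {x ∷ w} w∈ = drop-words k s (proj₁ (∈-words⁻ (k + s) w∈))

  length-candidates : ∀ t → length (candidates t) ≡ n * length (words t)
  length-candidates t = trans (length-cartesianProductWith _∷_ (allFin n) (words t))
    (cong (_* length (words t)) (List.length-tabulate {n = n} id))

  -- A conflicting extension of a word of length `d + s` is `z ++ v`, where `v` is good of length
  -- `s` and `z` is one of its conflicts. So these are counted by the good words of the smaller
  -- length `s`, a gain of `d` growth steps.
  repeating conflicting : ℕ → List Word
  repeating t = concatMap (λ w → map (_∷ w) (take (2 * d) w)) (words t)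
  conflicting s = concatMap (λ v → map (_++ v) (conflicts v)) (words s)

  length-repeating : ∀ t → length (repeating t) ≤ length (words t) * (2 * d)
  length-repeating t = ≤-trans (≤-reflexive (sym (+-identityʳ _))) (length-concatMap 1 (2 * d) (words t) λ {w} _ →
    ≤-trans (≤-reflexive (trans (+-identityʳ _) (trans (List.length-map (_∷ w) (take (2 * d) w)) (List.length-take (2 * d) w))))
      (m⊓n≤m (2 * d) (length w)))

  length-conflicting : ∀ s → 4 * length (conflicting s) ≤ length (words s) * (s * κ)
  length-conflicting s = length-concatMap 4 (s * κ) (words s) λ {v} v∈ →
    ≤-trans (≤-reflexive (cong (4 *_) (List.length-map (_++ v) (conflicts v))))
      (≤-trans (length-conflicts v) (≤-reflexive (cong (_* κ) (proj₂ (words-good s v∈)))))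

  classify : ∀ t (bad : List Word) →
    (∀ {x w} → w ∈ˡ words t → x ∷ take d w ∈ˡ conflicts (drop d w) → x ∷ w ∈ˡ bad) →
    n * length (words t) ≤ length (words (suc t)) + (length (words t) * (2 * d) + length bad)
  classify t bad conf = begin
    n * length (words t)                                                   ≡⟨ sym (length-candidates t) ⟩
    length (candidates t)                                                  ≤⟨ unique⇒length≤ (candidates-unique t) cover ⟩
    length (words (suc t) ++ repeating t ++ bad)                           ≡⟨ trans (List.length-++ (words (suc t)))
                                                                                (cong (length (words (suc t)) +_) (List.length-++ (repeating t))) ⟩
    length (words (suc t)) + (length (repeating t) + length bad)           ≤⟨ +-monoʳ-≤ (length (words (suc t))) (+-monoˡ-≤ (length bad) (length-repeating t)) ⟩
    length (words (suc t)) + (length (words t) * (2 * d) + length bad)     ∎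
    where
    open ≤-Reasoning
    cover : ∀ {z} → z ∈ˡ candidates t → z ∈ˡ words (suc t) ++ repeating t ++ bad
    cover z∈ with Mem.∈-cartesianProductWith⁻ _∷_ (allFin n) (words t) z∈
    ... | x , w , _ , w∈ , refl with x ∈ˡ? take (2 * d) w
    ... | yes x∈ = Mem.∈-++⁺ʳ (words (suc t)) (Mem.∈-++⁺ˡ
            (Mem.∈-concatMap⁺ _ (Any.map (λ { refl → Mem.∈-map⁺ (_∷ w) x∈ }) w∈)))
    ... | no x∉ with DecMem._∈?_ (List.≡-dec Fin._≟_) (x ∷ take d w) (conflicts (drop d w))
    ... | yes c∈ = Mem.∈-++⁺ʳ (words (suc t)) (Mem.∈-++⁺ʳ (repeating t) (conf w∈ c∈))
    ... | no c∉ = Mem.∈-++⁺ˡ (Mem.∈-filter⁺ good? z∈ (proj₁ (words-good t w∈) , x∉ , c∉))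

  -- For `t ≤ d` nothing lies beyond the last `d` letters, so there are no conflicts.
  short-step : ∀ t → t ≤ d → n * length (words t) ≤ length (words (suc t)) + length (words t) * (2 * d)
  short-step t t≤d = ≤-trans (classify t [] λ {x} {w} w∈ c∈ → contradiction
      (subst (λ v → x ∷ take d w ∈ˡ conflicts v) (List.drop-all d w (≤-trans (≤-reflexive (proj₂ (words-good t w∈))) t≤d)) c∈) λ ())
    (≤-reflexive (cong (length (words (suc t)) +_) (+-identityʳ _)))

  long-step : ∀ s → n * length (words (d + s)) ≤
    length (words (suc (d + s))) + (length (words (d + s)) * (2 * d) + length (conflicting s))
  long-step s = classify (d + s) (conflicting s) λ {x} {w} w∈ c∈ →
    subst (λ z → x ∷ z ∈ˡ conflicting s) (List.take++drop≡id d w)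
      (Mem.∈-concatMap⁺ _ (Any.map (λ { refl → Mem.∈-map⁺ (_++ drop d w) c∈ }) (drop-words d s w∈)))

  -- The alphabet is budgeted: `β` is the guaranteed growth factor, `γ` pays for conflicts and
  -- `2 * d` for repetitions.
  module Growth (β γ T : ℕ) (β+γ+2d≤n : β + γ + 2 * d ≤ n) (Tκ≤ : T * κ ≤ 4 * γ * β ^ d) where

    private
      V : ℕ → ℕ
      V t = length (words t)

      absorb : ∀ {v v⁺ e} → n * v ≤ v⁺ + (v * (2 * d) + e) → e ≤ γ * v → β * v ≤ v⁺
      absorb {v} {v⁺} {e} bound e≤ = +-cancelʳ-≤ (v * (2 * d) + γ * v) (β * v) v⁺ (begin
        β * v + (v * (2 * d) + γ * v)  ≡⟨ collect β γ (2 * d) v ⟩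
        (β + γ + 2 * d) * v            ≤⟨ *-monoˡ-≤ v β+γ+2d≤n ⟩
        n * v                          ≤⟨ bound ⟩
        v⁺ + (v * (2 * d) + e)         ≤⟨ +-monoʳ-≤ v⁺ (+-monoʳ-≤ (v * (2 * d)) e≤) ⟩
        v⁺ + (v * (2 * d) + γ * v)     ∎)
        where
        open ≤-Reasoning
        collect : ∀ β γ e v → β * v + (v * e + γ * v) ≡ (β + γ + e) * v
        collect = solve-∀

      iterate : ∀ k s → (∀ i → i <ⁿ k + s → β * V i ≤ V (suc i)) → β ^ k * V s ≤ V (k + s)
      iterate zero s _ = ≤-reflexive (+-identityʳ (V s))
      iterate (suc k) s grow = begin
        β * β ^ k * V s    ≡⟨ *-assoc β (β ^ k) (V s) ⟩
        β * (β ^ k * V s)  ≤⟨ *-monoʳ-≤ β (iterate k s λ i i< → grow i (m≤n⇒m≤1+n i<)) ⟩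
        β * V (k + s)      ≤⟨ grow (k + s) ≤-refl ⟩
        V (suc (k + s))    ∎
        where open ≤-Reasoning

      -- By the growth already established, `V (d + s)` is at least `β ^ d * V s`. The conflicts
      -- number at most `V s * (T * κ) / 4`, hence at most `γ * V (d + s)`.
      grow-step : ∀ t → t ≤ T → (∀ i → i <ⁿ t → β * V i ≤ V (suc i)) → β * V t ≤ V (suc t)
      grow-step t t≤T grow with t ≤? d
      ... | yes t≤d = absorb (≤-trans (short-step t t≤d) (+-monoʳ-≤ (V (suc t)) (m≤m+n _ 0))) z≤n
      ... | no t≰d = subst (λ t → β * V t ≤ V (suc t)) d+s≡t (absorb (long-step s) conflicts≤)
        where
        s = t ∸ d
        d+s≡t : d + s ≡ t
        d+s≡t = m+[n∸m]≡n (<⇒≤ (≰⇒> t≰d))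
        open ≤-Reasoning
        rearrange : ∀ v γ b → v * (4 * γ * b) ≡ 4 * (γ * (b * v))
        rearrange = solve-∀
        conflicts≤ : length (conflicting s) ≤ γ * V (d + s)
        conflicts≤ = *-cancelˡ-≤ 4 (begin
          4 * length (conflicting s)    ≤⟨ length-conflicting s ⟩
          V s * (s * κ)                 ≤⟨ *-monoʳ-≤ (V s) (*-monoˡ-≤ κ (≤-trans (m∸n≤m t d) t≤T)) ⟩
          V s * (T * κ)                 ≤⟨ *-monoʳ-≤ (V s) Tκ≤ ⟩
          V s * (4 * γ * β ^ d)         ≡⟨ rearrange (V s) γ (β ^ d) ⟩
          4 * (γ * (β ^ d * V s))       ≤⟨ *-monoʳ-≤ 4 (*-monoʳ-≤ γ (iterate d s λ i i< → grow i (subst (i <ⁿ_) d+s≡t i<))) ⟩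
          4 * (γ * V (d + s))           ∎)

      growth : ∀ t → t ≤ suc T → ∀ i → i <ⁿ t → β * V i ≤ V (suc i)
      growth (suc t) (s≤s t≤T) i (s≤s i≤t) with m≤n⇒m<n∨m≡n i≤t
      ... | inj₁ i<t = growth t (m≤n⇒m≤1+n t≤T) i i<t
      ... | inj₂ refl = grow-step t t≤T (growth t (m≤n⇒m≤1+n t≤T))

    good-word : 1 ≤ β → ∃[ w ] (Good w × length w ≡ T)
    good-word 1≤β = pick (words T) refl (≤-trans (m^n>0 β {{>-nonZero 1≤β}} T)
        (subst₂ _≤_ (*-identityʳ (β ^ T)) (cong V (+-identityʳ T))
          (iterate T 0 λ i i< → growth (suc T) ≤-refl i (m≤n⇒m≤1+n (subst (i <ⁿ_) (+-identityʳ T) i<)))))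
      where
      pick : ∀ ws → ws ≡ words T → 1 ≤ length ws → ∃[ w ] (Good w × length w ≡ T)
      pick (w ∷ _) eq _ = w , words-good T (subst (w ∈ˡ_) eq (here refl))

-- Elementary inequalities and the choice of parameters

-- `S` is the quotient plus one, even when the division is exact.
ceiling : ∀ X E → 1 ≤ E → ∃[ S ] (X ≤ S * E × S * E ≤ X + E)
ceiling X E@(suc _) _ = suc (X / E) , X≤ , ≤X+E
  where
  open ≤-Reasoning
  X≤ : X ≤ E + X / E * E
  X≤ = begin
    X                    ≡⟨ m≡m%n+[m/n]*n X E ⟩
    X % E + X / E * E    ≤⟨ +-monoˡ-≤ (X / E * E) (<⇒≤ (m%n<n X E)) ⟩
    E + X / E * E        ∎
  ≤X+E : E + X / E * E ≤ X + E
  ≤X+E = begin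
    E + X / E * E          ≤⟨ +-monoʳ-≤ E (m≤n+m _ (X % E)) ⟩
    E + (X % E + X / E * E) ≡⟨ cong (E +_) (sym (m≡m%n+[m/n]*n X E)) ⟩
    E + X                  ≡⟨ +-comm E X ⟩
    X + E                  ∎

m≤m^suc : ∀ m k → m ≤ m ^ suc k
m≤m^suc zero k = z≤n
m≤m^suc m@(suc _) k = ≤-trans (≤-reflexive (sym (*-identityʳ m))) (*-monoʳ-≤ m (m^n>0 m k))

^-distribʳ-* : ∀ k a b → (a * b) ^ k ≡ a ^ k * b ^ k
^-distribʳ-* zero a b = refl
^-distribʳ-* (suc k) a b = trans (cong (a * b *_) (^-distribʳ-* k a b)) (mid a b (a ^ k) (b ^ k))
  where
  mid : ∀ a b x y → a * b * (x * y) ≡ a * x * (b * y)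
  mid = solve-∀

-- Bernoulli's inequality for `(1 - b / (a + b)) ^ suc k`, cleared of subtraction and division.
bernoulli : ∀ a b k → (a + b) ^ suc k ≤ a ^ suc k + suc k * b * (a + b) ^ k
bernoulli a b zero = ≤-reflexive (base a b)
  where
  base : ∀ a b → (a + b) * 1 ≡ a * 1 + 1 * b * 1
  base = solve-∀
bernoulli a b (suc k) = begin
  (a + b) * P                                  ≡⟨ *-distribʳ-+ P a b ⟩
  a * P + b * P                                ≤⟨ +-monoˡ-≤ (b * P) (*-monoʳ-≤ a (bernoulli a b k)) ⟩
  a * (L + suc k * b * R) + b * P              ≡⟨ expand a b k L R P ⟩
  a * L + (suc k * b * (a * R) + b * P)        ≤⟨ +-monoʳ-≤ (a * L) (+-monoˡ-≤ (b * P) (*-monoʳ-≤ (suc k * b) (*-monoˡ-≤ R (m≤m+n a b)))) ⟩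
  a * L + (suc k * b * P + b * P)              ≡⟨ cong (a * L +_) (collect k b P) ⟩
  a * L + suc (suc k) * b * P                  ∎
  where
  open ≤-Reasoning
  L = a ^ suc k
  R = (a + b) ^ k
  P = (a + b) ^ suc k
  expand : ∀ a b k L R P → a * (L + suc k * b * R) + b * P ≡ a * L + (suc k * b * (a * R) + b * P)
  expand = solve-∀
  collect : ∀ k b P → suc k * b * P + b * P ≡ suc (suc k) * b * P
  collect = solve-∀

power-half : ∀ a b k → 2 * (suc k * b) ≤ a + b → (a + b) ^ suc k ≤ 2 * a ^ suc k
power-half a b k small = +-cancelʳ-≤ ((a + b) ^ suc k) _ _ (begin
  P + P                                    ≡⟨ double P ⟩
  2 * P                                    ≤⟨ *-monoʳ-≤ 2 (bernoulli a b k) ⟩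
  2 * (L + suc k * b * R)                  ≡⟨ expand L (suc k * b) R ⟩
  2 * L + 2 * (suc k * b) * R              ≤⟨ +-monoʳ-≤ (2 * L) (*-monoˡ-≤ R small) ⟩
  2 * L + P                                ∎)
  where
  open ≤-Reasoning
  L = a ^ suc k
  R = (a + b) ^ k
  P = (a + b) ^ suc k
  double : ∀ P → P + P ≡ 2 * P
  double = solve-∀
  expand : ∀ L c R → 2 * (L + c * R) ≡ 2 * L + 2 * c * R
  expand = solve-∀

-- With 2d q ≈ n, the choices β = (2d - 1) q and γ = q nearly maximise γ β^d subject to β + γ + 2d ≤ n.
module LowerBound (m : ℕ) where

  -- `p` is `2d - 1`. The slack `c` absorbs the rounding in `ceiling` and the `suc d` letters of the
  -- initial simplex. `N` makes `c` at most `n ^ suc m` and allows `power-half` to be applied to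
  -- `n = M + b`.
  d D p E c N : ℕ
  d = 2 + m
  D = 2 * d
  p = 3 + 2 * m
  E = d ! * 4 * d ^ 4
  c = (2 + d) * E
  N = 2 * (suc d * (2 * D)) + c

  private
    1≤E : 1 ≤ E
    1≤E = *-mono-≤ {1} {d ! * 4} (*-mono-≤ {1} (1≤n! d) (s≤s z≤n)) (m^n>0 d 4)

    1+p≡D : p + 1 ≡ D
    1+p≡D = lemma m
      where
      lemma : ∀ m → 3 + 2 * m + 1 ≡ 2 * (2 + m)
      lemma = solve-∀

    D^d≤2p^d : D ^ d ≤ 2 * p ^ d
    D^d≤2p^d = subst (λ x → x ^ d ≤ 2 * p ^ d) 1+p≡D (power-half p 1 (suc m) (≤-reflexive (lemma m)))
      where
      lemma : ∀ m → 2 * ((2 + m) * 1) ≡ 3 + 2 * m + 1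
      lemma = solve-∀

  module _ (n : ℕ) (N≤n : N ≤ n) where

    private
      X q ρ b M : ℕ
      X = n ^ suc m
      -- Setting `D` aside first leaves room for the `2 * d` forbidden letters; `b` joins it with
      -- the remainder, so `b` is below `2 * D`.
      q = (n ∸ D) / D
      ρ = (n ∸ D) % D
      b = D + ρ
      M = D * q

      2D≤n : 2 * D ≤ n
      2D≤n = ≤-trans (≤-trans (m≤m+n (2 * D) (d * (2 * D)))
        (≤-trans (m≤m+n (suc d * (2 * D)) (suc d * (2 * D) + 0)) (m≤m+n (2 * (suc d * (2 * D))) c))) N≤n

      D≤n : D ≤ n
      D≤n = ≤-trans (m≤m+n D (D + 0)) 2D≤n

      M+b≡n : M + b ≡ n
      M+b≡n = begin
        D * q + (D + ρ)    ≡⟨ lemma D q ρ ⟩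
        D + (ρ + q * D)    ≡⟨ cong (D +_) (sym (m≡m%n+[m/n]*n (n ∸ D) D)) ⟩
        D + (n ∸ D)        ≡⟨ m+[n∸m]≡n D≤n ⟩
        n                  ∎
        where
        open ≡-Reasoning
        lemma : ∀ D q ρ → D * q + (D + ρ) ≡ D + (ρ + q * D)
        lemma = solve-∀

      1≤q : 1 ≤ q
      1≤q = m≥n⇒m/n>0 (+-cancelˡ-≤ D D (n ∸ D) (≤-trans (≤-reflexive (cong (D +_) (sym (+-identityʳ D))))
        (≤-trans 2D≤n (≤-reflexive (sym (m+[n∸m]≡n D≤n))))))

      β : ℕ
      β = p * q

      budget : β + q + 2 * d ≤ n
      budget = ≤-trans (≤-reflexive (lemma p q D)) (≤-trans (≤-reflexive (cong (λ x → x * q + D) 1+p≡D))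
        (≤-trans (+-monoʳ-≤ (D * q) (m≤m+n D ρ)) (≤-reflexive M+b≡n)))
        where
        lemma : ∀ p q D → p * q + q + D ≡ (p + 1) * q + D
        lemma = solve-∀

      c≤X : c ≤ X
      c≤X = ≤-trans (≤-trans (m≤n+m c (2 * (suc d * (2 * D)))) N≤n) (m≤m^suc n m)

      n^≤2M^ : n ^ suc d ≤ 2 * M ^ suc d
      n^≤2M^ = subst (λ x → x ^ suc d ≤ 2 * M ^ suc d) M+b≡n (power-half M b d (begin
        2 * (suc d * b)          ≤⟨ *-monoʳ-≤ 2 (*-monoʳ-≤ (suc d) (+-monoʳ-≤ D (≤-trans (<⇒≤ (m%n<n (n ∸ D) D)) (m≤m+n D 0)))) ⟩
        2 * (suc d * (2 * D))    ≤⟨ m≤m+n _ c ⟩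
        N                        ≤⟨ N≤n ⟩
        n                        ≡⟨ sym M+b≡n ⟩
        M + b                    ∎))
        where open ≤-Reasoning

      open Words n m hiding (d)
      open Counting n m

      -- After multiplication by `4 * d`, three factors of 2 are lost: in `T * E ≤ X + X`, in
      -- `n ^ suc d ≤ 2 * M ^ suc d` and in `D ^ d ≤ 2 * p ^ d`. Their product `8 * M` equals
      -- `4 * d * (4 * q)`, since `M` is `2 * d * q`. The power `d ^ 4` arises from
      -- `(d + 1) * (d - 1) ≤ d * d`.
      few-conflicts : ∀ T → T * E ≤ X + c → T * κ ≤ 4 * q * β ^ d
      few-conflicts T TE≤ = *-cancelˡ-≤ (4 * d) (begin
        4 * d * (T * κ)                                  ≡⟨ expand m T n (d !) ⟩
        T * (d ! * 4) * (n * n) * (d * d * ((3 + m) * (1 + m)))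
                                                         ≤⟨ *-monoʳ-≤ (T * (d ! * 4) * (n * n)) (*-monoʳ-≤ (d * d) square) ⟩
        T * (d ! * 4) * (n * n) * (d * d * (d * d))      ≡⟨ regroup T (d !) n d ⟩
        T * E * (n * n)                                  ≤⟨ *-monoˡ-≤ (n * n) (≤-trans TE≤ (+-monoʳ-≤ X c≤X)) ⟩
        (X + X) * (n * n)                                ≡⟨ power n X ⟩
        2 * n ^ suc d                                    ≤⟨ *-monoʳ-≤ 2 n^≤2M^ ⟩
        2 * (2 * M ^ suc d)                              ≡⟨ cong (λ x → 2 * (2 * (M * x))) (^-distribʳ-* d D q) ⟩
        2 * (2 * (M * (D ^ d * q ^ d)))                  ≤⟨ *-monoʳ-≤ 2 (*-monoʳ-≤ 2 (*-monoʳ-≤ M (*-monoˡ-≤ (q ^ d) D^d≤2p^d))) ⟩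
        2 * (2 * (M * (2 * p ^ d * q ^ d)))              ≡⟨ collect d q (p ^ d) (q ^ d) ⟩
        4 * d * (4 * q * (p ^ d * q ^ d))                ≡⟨ cong (λ x → 4 * d * (4 * q * x)) (sym (^-distribʳ-* d p q)) ⟩
        4 * d * (4 * q * β ^ d)                          ∎)
        where
        open ≤-Reasoning
        square : (3 + m) * (1 + m) ≤ d * d
        square = ≤-trans (n≤1+n _) (≤-reflexive (lemma m))
          where
          lemma : ∀ m → suc ((3 + m) * (1 + m)) ≡ (2 + m) * (2 + m)
          lemma = solve-∀
        expand : ∀ m T n F → 4 * (2 + m) * (T * ((3 + m) * ((1 + m) * (2 + m) * (n * n) * F)))
          ≡ T * (F * 4) * (n * n) * ((2 + m) * (2 + m) * ((3 + m) * (1 + m)))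
        expand = solve-∀
        regroup : ∀ T F n d → T * (F * 4) * (n * n) * (d * d * (d * d)) ≡ T * (F * 4 * (d * (d * (d * (d * 1))))) * (n * n)
        regroup = solve-∀
        power : ∀ n X → (X + X) * (n * n) ≡ 2 * (n * (n * X))
        power = solve-∀
        collect : ∀ d q P Q → 2 * (2 * (2 * d * q * (2 * P * Q))) ≡ 4 * d * (4 * q * (P * Q))
        collect = solve-∀

    private
      Long : Set₁
      Long = ∃[ C ] (IsSCPM n d C × ∃[ F ] ∃[ G ] (C F × C G ×
        ((k : ℕ) → Walk C d F G k → X ≤ k * d ! * 4 * d ^ 4 * 2)))

      -- Completion only lengthens the word, so at least `S` subdivisions take place, and any walk
      -- between the two facets has length at least `S / 2`.
      word⇒long : ∀ S → X ≤ S * E → ∃[ w ] (Good w × length w ≡ S + suc d) → Long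
      word⇒long S X≤SE (w , good , len) =
        let v , good′ , w≤v , covers = complete (allFin n) w good
            d<v = ≤-trans (m≤n+m (suc d) S) (≤-trans (≤-reflexive (sym len)) w≤v)
            C , scpm , F , G , cF , cG , far = word-pseudomanifold (length v ∸ suc d) v
              (trans (sym (m∸n+n≡m d<v)) (+-suc (length v ∸ suc d) d)) good′ (λ i → covers (inj₁ (Mem.∈-allFin i)))
            S≤ = m+n≤o⇒m≤o∸n S (≤-trans (≤-reflexive (sym len)) w≤v)
        in C , scpm , F , G , cF , cG , λ k walk → begin
          X                            ≤⟨ X≤SE ⟩
          S * E                        ≤⟨ *-monoˡ-≤ E (≤-trans S≤ (far k walk)) ⟩
          2 * k * E                    ≡⟨ lemma k (d !) (d ^ 4) ⟩
          k * d ! * 4 * d ^ 4 * 2      ∎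
        where
        open ≤-Reasoning
        lemma : ∀ k F P → 2 * k * (F * 4 * P) ≡ k * F * 4 * P * 2
        lemma = solve-∀

      enough : ∀ S → S * E ≤ X + E → (S + suc d) * E ≤ X + c
      enough S SE≤ = begin
        (S + suc d) * E      ≡⟨ *-distribʳ-+ E S (suc d) ⟩
        S * E + suc d * E    ≤⟨ +-monoˡ-≤ (suc d * E) SE≤ ⟩
        X + E + suc d * E    ≡⟨ lemma X E d ⟩
        X + c                ∎
        where
        open ≤-Reasoning
        lemma : ∀ X E d → X + E + suc d * E ≡ X + (2 + d) * E
        lemma = solve-∀

    long-pseudomanifold : ∃[ C ] (IsSCPM n d C × ∃[ F ] ∃[ G ] (C F × C G ×
      ((k : ℕ) → Walk C d F G k → n ^ suc m ≤ k * d ! * 4 * d ^ 4 * 2)))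
    long-pseudomanifold =
      let S , X≤SE , SE≤ = ceiling X E 1≤E in
      word⇒long S X≤SE (Growth.good-word β q (S + suc d) budget (few-conflicts (S + suc d) (enough S SE≤))
        (*-mono-≤ {1} {p} (s≤s z≤n) 1≤q))

-- Passage to rational numbers and conclusion

toℚᵘ-ℕ : ∀ k → Q.toℚᵘ (ℕtoℚ k) Qᵘ.≃ Qᵘ.mkℚᵘ (Int.+ k) 0
toℚᵘ-ℕ k = Q.toℚᵘ-fromℚᵘ (Qᵘ.mkℚᵘ (Int.+ k) 0)

ℕtoℚ-≤-* : ∀ x y z → x ≤ y * z → ℕtoℚ x Q.≤ ℕtoℚ y Q.* ℕtoℚ z
ℕtoℚ-≤-* x y z x≤ = Q.toℚᵘ-cancel-≤
  (Qᵘ.≤-respˡ-≃ (Qᵘ.≃-sym (toℚᵘ-ℕ x))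
  (Qᵘ.≤-respʳ-≃ (Qᵘ.≃-sym (Qᵘ.≃-trans (Q.toℚᵘ-homo-* (ℕtoℚ y) (ℕtoℚ z)) (Qᵘ.*-cong (toℚᵘ-ℕ y) (toℚᵘ-ℕ z))))
  (Qᵘ.*≤* (subst₂ Int._≤_ (sym (ℤ.*-identityʳ (Int.+ x))) (trans (ℤ.pos-* y z) (sym (ℤ.*-identityʳ (Int.+ y Int.* Int.+ z)))) (Int.+≤+ x≤)))))

ℕtoℚ-nonNeg : ∀ k → Q.NonNegative (ℕtoℚ k)
ℕtoℚ-nonNeg k = Q.normalize-nonNeg k 1

-- The partial sum `eSum 1` is already 2.
2≤r : ∀ {r} → EulerLt r → ℕtoℚ 2 Q.≤ r
2≤r {r} (δ , 0<δ , bound) = Q.≤-trans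
  (Q.≤-trans (Q.≤-reflexive (sym (Q.+-identityʳ (eSum 1)))) (Q.+-monoʳ-≤ (eSum 1) (Q.<⇒≤ 0<δ))) (bound 1)

1-ε≤1 : ∀ {ε} → 0ℚ < ε → 1ℚ - ε Q.≤ 1ℚ
1-ε≤1 0<ε = Q.≤-trans (Q.+-monoʳ-≤ 1ℚ (Q.<⇒≤ (Q.neg-antimono-< 0<ε))) (Q.≤-reflexive (Q.+-identityʳ 1ℚ))

-- The integer bound has the constant 2 in place of Euler's number, so it suffices to estimate
-- `1ℚ - ε` by 1 and `r` from below by 2.
rational-bound : ∀ {ε r x y} → 0ℚ < ε → EulerLt r → x ≤ y * 2 → (1ℚ - ε) Q.* ℕtoℚ x Q.≤ ℕtoℚ y Q.* r
rational-bound {ε} {r} {x} {y} 0<ε e<r x≤2y = begin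
  (1ℚ - ε) Q.* ℕtoℚ x   ≤⟨ Q.*-monoʳ-≤-nonNeg (ℕtoℚ x) {{ℕtoℚ-nonNeg x}} (1-ε≤1 0<ε) ⟩
  1ℚ Q.* ℕtoℚ x         ≡⟨ Q.*-identityˡ (ℕtoℚ x) ⟩
  ℕtoℚ x                ≤⟨ ℕtoℚ-≤-* x y 2 x≤2y ⟩
  ℕtoℚ y Q.* ℕtoℚ 2     ≤⟨ Q.*-monoˡ-≤-nonNeg (ℕtoℚ y) {{ℕtoℚ-nonNeg y}} (2≤r e<r) ⟩
  ℕtoℚ y Q.* r          ∎
  where open Q.≤-Reasoning

theorem3 : (d : ℕ) → 3 ≤ d →
    ((ε : ℚ) → 0ℚ < ε → (r : ℚ) → EulerLt r →
    ∃[ N ] ((n : ℕ) → N ≤ n →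
    ∃[ C ] (IsSCPM n d C × ∃[ F ] ∃[ G ] (C F × C G ×
    ((k : ℕ) → Walk C d F G k →
    (1ℚ - ε) Q.* ℕtoℚ (n ^ (d ∸ 1))
    Q.≤ ℕtoℚ (k * d ! * 4 * d ^ 4) Q.* r)))))
    × (∃[ N ] ((n : ℕ) → N ≤ n → (C : Complex n) → IsSCPM n d C →
    ∀ F G → C F → C G →
    ∃[ k ] (Walk C d F G k × k * d ! * (d + 1) ≤ 6 * n ^ (d ∸ 1))))
theorem3 (suc zero) (s≤s ())
theorem3 (suc (suc m)) _ =
  (λ ε 0<ε r e<r → LowerBound.N m , λ n N≤n →
    let C , scpm , F , G , cF , cG , far = LowerBound.long-pseudomanifold m n N≤n in
    C , scpm , F , G , cF , cG , λ k walk →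
      rational-bound {y = k * (2 + m) ! * 4 * (2 + m) ^ 4} 0<ε e<r (far k walk)) ,
  (0 , λ n _ C scpm → Diameter.diameter-bound C (suc m) scpm)
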